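{- For each fixed integer $t\ge 2$, $\mathrm{Ex}(S_0^{(t)},n)\ge n2^{(1-o(1))\sqrt{\log t\,\log n}}$ as $n\to\infty$, where $S_0^{(t)}$ is the $3\times 2t$ 0--1 matrix with rows indexed $0,1,2$ and columns indexed $0,1,\dots,2t-1$ in which row $0$ has 1s exactly in the even-indexed columns $0,2,4,\dots,2t-2$, row $1$ has 1s exactly in columns $0$ and $2t-1$, and row $2$ has 1s exactly in the odd-indexed columns $1,3,\dots,2t-3,2t-1$.
   Context: A pattern is a 0--1 matrix. A 0--1 matrix $A$ contains a pattern $P$ if $A$ can be transformed into $P$ by removing rows and columns from $A$ (keeping the order of the remaining ones) and changing some 1s to 0s; otherwise $A$ is $P$-free. $\mathrm{Ex}(P,n)$ is the maximum number of 1s in an $n\times n$ 0--1 matrix that is $P$-free. $\log$ is the binary logarithm. -}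

module Defs where

import Algebra.Definitions.RawSemiring
open import Data.Bool.Base using (Bool; true; false; _∨_)
open import Data.Bool.Properties using () renaming (_≟_ to _≟ᵇ_)
open import Data.Fin.Base as Fin using (Fin; toℕ; finToFun; funToFin)
import Data.Fin.Properties as Fin
open import Data.Integer.Base as ℤ using (ℤ; +_; -[1+_])
open import Data.List.Base as List using (List; cartesianProductWith; filter)
import Data.List.Extrema.Nat as Extrema
open import Data.List.Membership.Propositional using (_∈_; lose)
open import Data.List.Membership.Propositional.Properties
  using (∈-cartesianProductWith⁺; ∈-filter⁺; ∈-filter⁻; ∈-map⁺; ∈-map⁻)
open import Data.List.Relation.Unary.Any using (here; there)
open import Data.Nat.Base as ℕ using (ℕ; zero; suc)
import Data.Nat.Properties as ℕ
open import Data.Product.Base using (∃; ∃₂; _×_; _,_)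
open import Data.Rational.Base as ℚ using (ℚ; 0ℚ; ½; ↥_; ↧ₙ_; _/_)
open import Data.Sum.Base using (_⊎_; inj₁; inj₂)
open import Data.Vec.Base as Vec using (Vec; []; _∷_; lookup; tabulate; countᵇ)
open import Function.Base using (_∘_; id)
open import Level using (0ℓ)
open import Relation.Binary.Core using (_Preserves_⟶_)
open import Relation.Binary.PropositionalEquality
  using (_≡_; _≗_; refl; sym; trans; cong₂; subst; subst₂)
open import Relation.Nullary using (Dec; ¬_; ¬?)
open import Relation.Nullary.Decidable using (map′; _×-dec_; _→-dec_)
open import Relation.Unary using (Pred; Decidable; _⊆_)

Matrix : ℕ → ℕ → Set
Matrix m n = Vec (Vec Bool n) m

entry : ∀ {m n} → Matrix m n → Fin m → Fin n → Bool
entry A i j = lookup (lookup A i) j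

weight : ∀ {m n} → Matrix m n → ℕ
weight A = Vec.sum (Vec.map (countᵇ id) A)

StrictlyIncreasing : ∀ {k m} → (Fin k → Fin m) → Set
StrictlyIncreasing f = f Preserves Fin._<_ ⟶ Fin._<_

-- `ρ` and `κ` select, in order, the rows and columns of `A` that are kept;
-- the remaining submatrix must have a 1 wherever `P` has one.
EmbedsVia : ∀ {k l m n} → Matrix k l → Matrix m n →
            (Fin k → Fin m) → (Fin l → Fin n) → Set
EmbedsVia P A ρ κ =
  StrictlyIncreasing ρ × StrictlyIncreasing κ ×
  (∀ i j → entry P i j ≡ true → entry A (ρ i) (κ j) ≡ true)

_Contains_ : ∀ {k l m n} → Matrix m n → Matrix k l → Set
A Contains P = ∃₂ λ ρ κ → EmbedsVia P A ρ κ

Free : ∀ {k l m n} → Matrix k l → Pred (Matrix m n) 0ℓ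
Free P A = ¬ (A Contains P)

private
  anyFunction? : ∀ {k m} {Q : (Fin k → Fin m) → Set} →
                 (∀ {f g} → f ≗ g → Q f → Q g) → Decidable Q → Dec (∃ Q)
  anyFunction? resp Q? = map′
    (λ (c , q) → finToFun c , q)
    (λ (f , q) → funToFin f , resp (sym ∘ Fin.finToFun-funToFin f) q)
    (Fin.any? (Q? ∘ finToFun))

  increasing? : ∀ {k m} → Decidable (StrictlyIncreasing {k} {m})
  increasing? f = map′ (λ h {i} {j} → h i j) (λ h i j → h {i} {j})
    (Fin.all? λ i → Fin.all? λ j → (i Fin.<? j) →-dec (f i Fin.<? f j))

  increasing-resp : ∀ {k m} {f g : Fin k → Fin m} → f ≗ g →
                    StrictlyIncreasing f → StrictlyIncreasing g
  increasing-resp f≗g inc {i} {j} i<j =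
    subst₂ Fin._<_ (f≗g i) (f≗g j) (inc i<j)

  embedsVia-resp : ∀ {k l m n} {P : Matrix k l} {A : Matrix m n}
                   {ρ ρ′ κ κ′} → ρ ≗ ρ′ → κ ≗ κ′ →
                   EmbedsVia P A ρ κ → EmbedsVia P A ρ′ κ′
  embedsVia-resp {A = A} ρ≗ κ≗ (incρ , incκ , h) =
    increasing-resp ρ≗ incρ , increasing-resp κ≗ incκ ,
    λ i j p → trans (cong₂ (entry A) (sym (ρ≗ i)) (sym (κ≗ j))) (h i j p)

contains? : ∀ {k l m n} (A : Matrix m n) (P : Matrix k l) → Dec (A Contains P)
contains? A P =
  anyFunction?
    (λ ρ≗ (κ , e) → κ , embedsVia-resp {P = P} {A} ρ≗ (λ _ → refl) e) λ ρ →
  anyFunction?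
    (λ κ≗ e → embedsVia-resp {P = P} {A} (λ _ → refl) κ≗ e) λ κ →
  increasing? ρ ×-dec increasing? κ ×-dec
  (Fin.all? λ i → Fin.all? λ j →
    (entry P i j ≟ᵇ true) →-dec (entry A (ρ i) (κ j) ≟ᵇ true))

free? : ∀ {k l m n} (P : Matrix k l) → Decidable (Free {m = m} {n} P)
free? P A = ¬? (contains? A P)

allVecs : ∀ {A : Set} → List A → ∀ n → List (Vec A n)
allVecs xs zero    = [] List.∷ List.[]
allVecs xs (suc n) = cartesianProductWith _∷_ xs (allVecs xs n)

allMatrices : ∀ m n → List (Matrix m n)
allMatrices m n = allVecs (allVecs (false List.∷ true List.∷ List.[]) n) m

-- If every n × n matrix contains P (so P has no 1s), this is 0.
Ex : ∀ {k l} → Matrix k l → ℕ → ℕ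
Ex P n = Extrema.max 0 (List.map weight (filter (free? P) (allMatrices n n)))

∈-allVecs : ∀ {A : Set} {xs : List A} → (∀ x → x ∈ xs) →
            ∀ {n} (v : Vec A n) → v ∈ allVecs xs n
∈-allVecs all []      = here refl
∈-allVecs all (x ∷ v) = ∈-cartesianProductWith⁺ _∷_ (all x) (∈-allVecs all v)

∈-allMatrices : ∀ {m n} (A : Matrix m n) → A ∈ allMatrices m n
∈-allMatrices = ∈-allVecs (∈-allVecs λ where
  false → here refl
  true  → there (here refl))

weight≤Ex : ∀ {k l n} (P : Matrix k l) (A : Matrix n n) →
            Free P A → weight A ℕ.≤ Ex P n
weight≤Ex P A free = Extrema.v≤max⁺ 0 _ (inj₂ (lose
  (∈-map⁺ weight (∈-filter⁺ (free? P) (∈-allMatrices A) free)) ℕ.≤-refl))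

Ex-attained : ∀ {k l n} (P : Matrix k l) → ∃ (Free {m = n} {n} P) →
              ∃ λ (A : Matrix n n) → Free P A × weight A ≡ Ex P n
Ex-attained {n = n} P (A₀ , free₀)
  with Extrema.argmax-sel id 0 (List.map weight (filter (free? P) (allMatrices n n)))
... | inj₁ Ex≡0 = A₀ , free₀ ,
  trans (ℕ.n≤0⇒n≡0 (subst (weight A₀ ℕ.≤_) Ex≡0 (weight≤Ex P A₀ free₀))) (sym Ex≡0)
... | inj₂ Ex∈ with ∈-map⁻ weight Ex∈
... | A , A∈ , Ex≡ with ∈-filter⁻ (free? P) {xs = allMatrices n n} A∈
... | _ , free = A , free , sym Ex≡

S₀ : ∀ t → Matrix 3 (2 ℕ.* t)
S₀ t = tabulate (λ j → (toℕ j ℕ.% 2) ℕ.≡ᵇ 0)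
     ∷ tabulate (λ j → (toℕ j ℕ.≡ᵇ 0) ∨ (toℕ j ℕ.≡ᵇ (2 ℕ.* t ℕ.∸ 1)))
     ∷ tabulate (λ j → (toℕ j ℕ.% 2) ℕ.≡ᵇ 1)
     ∷ []

-- A real number x is represented by its open lower cut { q ∈ ℚ | q < x }, so
-- that x ≤ y is inclusion of cuts.  (The empty cut plays the role of -∞.)
Real : Set₁
Real = Pred ℚ 0ℓ

infix 4 _≤ᴿ_
_≤ᴿ_ : Real → Real → Set
x ≤ᴿ y = x ⊆ y

fromℚ : ℚ → Real
fromℚ p q = q ℚ.< p

ℕ→ℚ : ℕ → ℚ
ℕ→ℚ n = + n / 1

fromℕ : ℕ → Real
fromℕ n = fromℚ (ℕ→ℚ n)

-- Multiplication and square root are those of nonnegative reals; a negative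
-- argument is treated as 0.
infixl 7 _*ᴿ_
_*ᴿ_ : Real → Real → Real
(x *ᴿ y) q = q ℚ.< 0ℚ ⊎
  ∃₂ λ a b → x a × y b × 0ℚ ℚ.≤ a × 0ℚ ℚ.≤ b × q ℚ.≤ a ℚ.* b

√ : Real → Real
√ x q = q ℚ.< 0ℚ ⊎ x (q ℚ.* q)

open Algebra.Definitions.RawSemiring ℚ.+-*-rawSemiring public
  using () renaming (_^_ to _^ℚ_)

2^ℤ : ℤ → ℚ
2^ℤ (+ n)    = ℕ→ℚ 2 ^ℚ n
2^ℤ -[1+ n ] = ½ ^ℚ suc n

-- For r = p / d with d > 0:  r < log₂ n  iff  2^p < n^d.
log₂ : ℕ → Real
log₂ n r = 2^ℤ (↥ r) ℚ.< ℕ→ℚ (n ℕ.^ ↧ₙ r)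

-- q < 2^x  iff  q < 0  or  q ≤ 2^r for some rational r < x; for r = p / d and
-- q ≥ 0, the inequality q ≤ 2^r means q^d ≤ 2^p.
exp₂ : Real → Real
exp₂ x q = q ℚ.< 0ℚ ⊎ ∃ λ r → x r × q ^ℚ ↧ₙ r ℚ.≤ 2^ℤ (↥ r)

{-# OPTIONS --safe #-}
-- A row is a time index s with numbers r₁ … r_d, a column is a sequence of lines (p₁ , v₁) … (p_d , v_d)
-- with slopes v_ℓ < t, and they are incident when r_ℓ = p_ℓ + h(s) v_ℓ for all ℓ.  Rows are ordered by s
-- first, columns lexicographically.  In a copy of S₀ the three rows have time indices s < s′ < s″, and at the
-- first level where the 2t columns are not all equal, the lines of the even columns meet at time h(s), those of
-- the odd columns meet at time h(s″), and the two extreme ones meet at time h(s′).  If the values of h are close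
-- together, the alternation then forces v to take more than t values, unless h(s′) is a mean of h(s) and h(s″)
-- with weights of sum < t.  A Behrend-type h, which lifts digit vectors to a paraboloid, excludes such means and
-- has values of size S ^ (1 + o(1)) on S arguments.  Every column has S ones; taking S = t ^ (u k) and d = u k + 1
-- gives n = t ^ ((1 + o(1)) (u k)²) when first k and then u is large.

module Submission where

open import Defs

module Combinatorics where

  open import Data.Bool.Base using (Bool; true; false; _∨_; if_then_else_)
  open import Data.Empty using (⊥; ⊥-elim)
  open import Data.Fin.Base using (Fin; zero; suc; toℕ)
  import Data.Fin.Properties as Fin
  open import Data.Nat.Base
  open import Data.Nat.DivMod
  open import Data.Nat.Properties
  open import Data.Nat.Tactic.RingSolver using (solve-∀)
  open import Data.Product.Base using (∃; _×_; _,_; proj₁; proj₂)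
  open import Data.Sum.Base using (_⊎_; inj₁; inj₂; [_,_]′)
  open import Data.Vec.Base as Vec using (tabulate; countᵇ)
  import Data.Vec.Properties as Vec
  open import Function.Base using (id; _∘_)
  open import Relation.Binary.Definitions using (tri<; tri≈; tri>)
  open import Relation.Binary.PropositionalEquality
  open import Relation.Nullary using (Dec; yes; does; contradiction)
  open import Relation.Nullary.Decidable using (_×-dec_; dec-true)

  -- Times without weighted means

  leading-digit-< : ∀ {a a′ b} b′ {n} → a < a′ → b < n → a * n + b < a′ * n + b′
  leading-digit-< {a} {a′} {b} b′ {n} a<a′ b<n = begin-strict
    a * n + b    <⟨ +-monoʳ-< (a * n) b<n ⟩
    a * n + n    ≡⟨ +-comm (a * n) n ⟩
    suc a * n    ≤⟨ *-monoˡ-≤ n a<a′ ⟩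
    a′ * n       ≤⟨ m≤m+n (a′ * n) b′ ⟩
    a′ * n + b′  ∎
    where open ≤-Reasoning

  digits-unique : ∀ {a a′ b b′ n} → b < n → b′ < n →
                  a * n + b ≡ a′ * n + b′ → a ≡ a′ × b ≡ b′
  digits-unique {a} {a′} {b} {b′} {n} b<n b′<n eq with <-cmp a a′
  ... | tri< a<a′ _ _ = contradiction eq (<⇒≢ (leading-digit-< b′ a<a′ b<n))
  ... | tri> _ _ a>a′ = contradiction (sym eq) (<⇒≢ (leading-digit-< b a>a′ b′<n))
  ... | tri≈ _ refl _ = refl , +-cancelˡ-≡ (a * n) b b′ eq

  digits-< : ∀ {a b n A B} → a < A → b < n → A * n ≤ B → a * n + b < B
  digits-< {a} {b} {n} {A} {B} a<A b<n An≤B = begin-strict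
    a * n + b  <⟨ leading-digit-< 0 a<A b<n ⟩
    A * n + 0  ≡⟨ +-identityʳ (A * n) ⟩
    A * n      ≤⟨ An≤B ⟩
    B          ∎
    where open ≤-Reasoning

  /-%-injective : ∀ {m n} q .{{_ : NonZero q}} → m / q ≡ n / q → m % q ≡ n % q → m ≡ n
  /-%-injective {m} {n} q m/q≡n/q m%q≡n%q = begin
    m                    ≡⟨ m≡m%n+[m/n]*n m q ⟩
    m % q + (m / q) * q  ≡⟨ cong₂ (λ r d → r + d * q) m%q≡n%q m/q≡n/q ⟩
    n % q + (n / q) * q  ≡⟨ m≡m%n+[m/n]*n n q ⟨
    n                    ∎
    where open ≡-Reasoning

  /≡⇒%< : ∀ {m n} q .{{_ : NonZero q}} → m < n → m / q ≡ n / q → m % q < n % q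
  /≡⇒%< {m} {n} q m<n m/q≡n/q = +-cancelʳ-< ((m / q) * q) (m % q) (n % q) (begin-strict
    m % q + (m / q) * q  ≡⟨ m≡m%n+[m/n]*n m q ⟨
    m                    <⟨ m<n ⟩
    n                    ≡⟨ m≡m%n+[m/n]*n n q ⟩
    n % q + (n / q) * q  ≡⟨ cong (λ d → n % q + d * q) m/q≡n/q ⟨
    n % q + (m / q) * q  ∎)
    where open ≤-Reasoning

  StrictlyMonotoneBelow : ℕ → (ℕ → ℕ) → Set
  StrictlyMonotoneBelow S h = ∀ {s s′} → s < s′ → s′ < S → h s < h s′

  -- For `t` = 3 the only weights are `i` = `w` = 1, and the condition excludes midpoints, as in
  -- Behrend's sets without three-term progressions.
  NoWeightedMean : ℕ → ℕ → (ℕ → ℕ) → Set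
  NoWeightedMean t S h = ∀ {i w s s′ s″} → 0 < i → 0 < w → i + w < t →
    s < s″ → s′ < S → s″ < S → (i + w) * h s′ ≢ i * h s + w * h s″

  -- The square of a weighted mean falls short of the weighted mean of the squares by the variance,
  -- here multiplied through by the square of `i + w`.
  variance-identity : ∀ {i w x x′ x″} → (i + w) * x′ ≡ i * x + w * x″ →
    (i + w) * ((i + w) * (x′ * x′)) + i * w * (∣ x - x″ ∣ * ∣ x - x″ ∣)
      ≡ (i + w) * (i * (x * x) + w * (x″ * x″))
  variance-identity {i} {w} {x} {x′} {x″} eq = trans
    (cong (_+ i * w * (∣ x - x″ ∣ * ∣ x - x″ ∣)) (trans (square (i + w) x′) (cong (λ m → m * m) eq)))
    completed
    where
    square : ∀ T y → T * (T * (y * y)) ≡ T * y * (T * y)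
    square = solve-∀
    ordered : ∀ i w x δ → (i * x + w * (x + δ)) * (i * x + w * (x + δ)) + i * w * (δ * δ)
                          ≡ (i + w) * (i * (x * x) + w * ((x + δ) * (x + δ)))
    ordered = solve-∀
    ordered′ : ∀ i w x δ → (i * (x + δ) + w * x) * (i * (x + δ) + w * x) + i * w * (δ * δ)
                           ≡ (i + w) * (i * ((x + δ) * (x + δ)) + w * (x * x))
    ordered′ = solve-∀
    completed : (i * x + w * x″) * (i * x + w * x″) + i * w * (∣ x - x″ ∣ * ∣ x - x″ ∣)
                ≡ (i + w) * (i * (x * x) + w * (x″ * x″))
    completed with ≤-total x x″
    ... | inj₁ x≤x″ with x″ ∸ x | m+[n∸m]≡n x≤x″
    ...   | δ | refl rewrite ∣m-m+n∣≡n x δ = ordered i w x δ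
    completed | inj₂ x″≤x with x ∸ x″ | m+[n∸m]≡n x″≤x
    ...   | δ | refl rewrite trans (∣-∣-comm (x″ + δ) x″) (∣m-m+n∣≡n x″ δ) = ordered′ i w x″ δ

  -- A number s < q ^ k is the vector x of its k base-q digits.
  module Paraboloid (b q : ℕ) .{{_ : NonZero q}} where

    -- The base-`q` digits are reread in base `b`. Once `t * q ≤ b`, sums of digit vectors with
    -- total weight below `t` produce no carries.
    spread : ℕ → ℕ → ℕ
    spread zero    s = 0
    spread (suc k) s = spread k (s / q) * b + s % q

    normSq : ℕ → ℕ → ℕ
    normSq zero    s = 0
    normSq (suc k) s = normSq k (s / q) + (s % q) * (s % q)

    distSq : ℕ → ℕ → ℕ → ℕ
    distSq zero    s s′ = 0
    distSq (suc k) s s′ = distSq k (s / q) (s′ / q) + ∣ s % q - s′ % q ∣ * ∣ s % q - s′ % q ∣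

    private
      drop-digit : ∀ k {s} → s < q ^ suc k → s / q < q ^ k
      drop-digit k {s} s<q^1+k = m<n*o⇒m/o<n (subst (s <_) (*-comm q (q ^ k)) s<q^1+k)

    distSq≡0⇒≡ : ∀ k {s s′} → s < q ^ k → s′ < q ^ k → distSq k s s′ ≡ 0 → s ≡ s′
    distSq≡0⇒≡ zero    s<1 s′<1 _ = trans (n<1⇒n≡0 s<1) (sym (n<1⇒n≡0 s′<1))
    distSq≡0⇒≡ (suc k) {s} {s′} s< s′< eq = /-%-injective q
      (distSq≡0⇒≡ k (drop-digit k s<) (drop-digit k s′<) (m+n≡0⇒m≡0 _ eq))
      (∣m-n∣≡0⇒m≡n ([ id , id ]′ (m*n≡0⇒m≡0∨n≡0 _ (m+n≡0⇒n≡0 (distSq k _ _) eq))))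

    -- Each digit adds at most `q * q`, for which doubling at every step is ample. The crude factor
    -- `2 ^ k` is later absorbed into a power of `t`.
    normSq-< : ∀ k {m} s → 0 < m → q * q ≤ m → normSq k s < m * 2 ^ k
    normSq-< zero    {m} s 0<m _    = subst (0 <_) (sym (*-identityʳ m)) 0<m
    normSq-< (suc k) {m} s 0<m qq≤m = begin-strict
      normSq k (s / q) + s % q * (s % q)  <⟨ +-mono-<-≤ (normSq-< k (s / q) 0<m qq≤m) (*-mono-≤ (m%n≤n s q) (m%n≤n s q)) ⟩
      m * 2 ^ k + q * q                   ≤⟨ +-monoʳ-≤ (m * 2 ^ k) qq≤m ⟩
      m * 2 ^ k + m                       ≤⟨ +-monoʳ-≤ (m * 2 ^ k) (m≤m*n m (2 ^ k) {{m^n≢0 2 k}}) ⟩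
      m * 2 ^ k + m * 2 ^ k               ≡⟨ double m (2 ^ k) ⟩
      m * (2 * 2 ^ k)                     ∎
      where
      open ≤-Reasoning
      double : ∀ m n → m * n + m * n ≡ m * (2 * n)
      double = solve-∀

    module _ (q≤b : q ≤ b) where

      private
        s%q<b : ∀ s → s % q < b
        s%q<b s = <-≤-trans (m%n<n s q) q≤b

      spread-< : ∀ k {s} → s < q ^ k → spread k s < b ^ k
      spread-< zero    _  = z<s
      spread-< (suc k) {s} s< = digits-< (spread-< k (drop-digit k s<)) (s%q<b s) (≤-reflexive (*-comm (b ^ k) b))

      spread-mono-< : ∀ k → StrictlyMonotoneBelow (q ^ k) (spread k)
      spread-mono-< zero    s<s′ s′<1 = contradiction (n<1⇒n≡0 s′<1) (m<n⇒n≢0 s<s′)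
      spread-mono-< (suc k) {s} {s′} s<s′ s′< with m≤n⇒m<n∨m≡n (/-monoˡ-≤ q (<⇒≤ s<s′))
      ... | inj₁ s/q<s′/q = leading-digit-< (s′ % q) (spread-mono-< k s/q<s′/q (drop-digit k s′<)) (s%q<b s)
      ... | inj₂ s/q≡s′/q rewrite s/q≡s′/q = +-monoʳ-< (spread k (s′ / q) * b) (/≡⇒%< q s<s′ s/q≡s′/q)

    -- As `(i + w) * q < t * q ≤ b`, the hypothesis involves no carries and holds digit by digit.
    -- The variance identities of the digits are then added up.
    normSq-mean : ∀ {t i w} → i + w < t → t * q ≤ b → ∀ k {s s′ s″} →
      (i + w) * spread k s′ ≡ i * spread k s + w * spread k s″ →
      (i + w) * ((i + w) * normSq k s′) + i * w * distSq k s s″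
        ≡ (i + w) * (i * normSq k s + w * normSq k s″)
    normSq-mean {t} {i} {w} i+w<t tq≤b zero _ = base i w
      where
      base : ∀ i w → (i + w) * ((i + w) * 0) + i * w * 0 ≡ (i + w) * (i * 0 + w * 0)
      base = solve-∀
    normSq-mean {t} {i} {w} i+w<t tq≤b (suc k) {s} {s′} {s″} eq = begin
      (i + w) * ((i + w) * (E′ + x′ * x′)) + i * w * (Δ + δ * δ)
        ≡⟨ split-left i w E′ (x′ * x′) Δ (δ * δ) ⟩
      ((i + w) * ((i + w) * E′) + i * w * Δ) + ((i + w) * ((i + w) * (x′ * x′)) + i * w * (δ * δ))
        ≡⟨ cong₂ _+_ (normSq-mean {i = i} {w} i+w<t tq≤b k {s / q} {s′ / q} {s″ / q} (proj₁ separate))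
            (variance-identity {i} {w} {x} {x′} {x″} (proj₂ separate)) ⟩
      (i + w) * (i * E + w * E″) + (i + w) * (i * (x * x) + w * (x″ * x″))
        ≡⟨ split-right i w E E″ (x * x) (x″ * x″) ⟨
      (i + w) * (i * (E + x * x) + w * (E″ + x″ * x″)) ∎
      where
      open ≡-Reasoning
      x = s % q
      x′ = s′ % q
      x″ = s″ % q
      E = normSq k (s / q)
      E′ = normSq k (s′ / q)
      E″ = normSq k (s″ / q)
      Δ = distSq k (s / q) (s″ / q)
      δ = ∣ x - x″ ∣
      split-left : ∀ i w a b c d → (i + w) * ((i + w) * (a + b)) + i * w * (c + d)
        ≡ ((i + w) * ((i + w) * a) + i * w * c) + ((i + w) * ((i + w) * b) + i * w * d)
      split-left = solve-∀
      split-right : ∀ i w a b c d → (i + w) * (i * (a + c) + w * (b + d))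
        ≡ (i + w) * (i * a + w * b) + (i + w) * (i * c + w * d)
      split-right = solve-∀
      expand₁ : ∀ T g c x → T * (g * c + x) ≡ T * g * c + T * x
      expand₁ = solve-∀
      expand₂ : ∀ i w g g″ c x x″ → i * (g * c + x) + w * (g″ * c + x″) ≡ (i * g + w * g″) * c + (i * x + w * x″)
      expand₂ = solve-∀
      below-b : ∀ {n} → n ≤ (i + w) * q → n < b
      below-b n≤ = <-≤-trans (≤-<-trans n≤ (*-monoˡ-< q i+w<t)) tq≤b
      separate = digits-unique {(i + w) * spread k (s′ / q)} {i * spread k (s / q) + w * spread k (s″ / q)}
        (below-b (*-monoʳ-≤ (i + w) (m%n≤n s′ q)))
        (below-b (≤-trans (+-mono-≤ (*-monoʳ-≤ i (m%n≤n s q)) (*-monoʳ-≤ w (m%n≤n s″ q))) (≤-reflexive (sym (*-distribʳ-+ q i w)))))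
        (trans (sym (expand₁ (i + w) (spread k (s′ / q)) b x′))
            (trans eq (expand₂ i w (spread k (s / q)) (spread k (s″ / q)) b x x″)))

    -- The point (x, |x|²) of the paraboloid packed into one integer. The shift by a large `M` makes
    -- differences small relative to the values.
    lift : ℕ → ℕ → ℕ → ℕ → ℕ
    lift M Q k s = M + (spread k s * Q + normSq k s)

    module _ {t Q : ℕ} (M k : ℕ) (q≤b : q ≤ b) (tq≤b : t * q ≤ b) (norm< : ∀ s → t * normSq k s < Q) (0<t : 0 < t) where

      private
        normSq<Q : ∀ s → normSq k s < Q
        normSq<Q s = ≤-<-trans (m≤n*m (normSq k s) t {{>-nonZero 0<t}}) (norm< s)

      lift-< : ∀ {s} → s < q ^ k → lift M Q k s < M + b ^ k * Q
      lift-< {s} s< = +-monoʳ-< M (digits-< (spread-< q≤b k s<) (normSq<Q s) ≤-refl)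

      lift-mono-< : StrictlyMonotoneBelow (q ^ k) (lift M Q k)
      lift-mono-< {s} {s′} s<s′ s′< = +-monoʳ-< M (leading-digit-< (normSq k s′) (spread-mono-< q≤b k s<s′ s′<) (normSq<Q s))

      -- Base `Q` separates the mean relation into one for the spreads and one for the norms. By
      -- `normSq-mean` the two together leave no room for a positive distance: a paraboloid contains
      -- no proper mean of two of its points.
      lift-noWeightedMean : NoWeightedMean t (q ^ k) (lift M Q k)
      lift-noWeightedMean {i} {w} {s} {s′} {s″} 0<i 0<w i+w<t s<s″ s′< s″< eq =
        <⇒≢ s<s″ (distSq≡0⇒≡ k (<-trans s<s″ s″<) s″< distSq≡0)
        where
        expand₁ : ∀ T m g c x → T * (m + (g * c + x)) ≡ T * m + (T * g * c + T * x)
        expand₁ = solve-∀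
        expand₂ : ∀ i w m g g″ c x x″ → i * (m + (g * c + x)) + w * (m + (g″ * c + x″))
            ≡ (i + w) * m + ((i * g + w * g″) * c + (i * x + w * x″))
        expand₂ = solve-∀
        below-Q : ∀ s → (i + w) * normSq k s < Q
        below-Q s = ≤-<-trans (*-monoˡ-≤ (normSq k s) (<⇒≤ i+w<t)) (norm< s)
        below-Q″ : i * normSq k s + w * normSq k s″ < Q
        below-Q″ with ≤-total (normSq k s) (normSq k s″)
        ... | inj₁ e≤e″ = ≤-<-trans (≤-trans (+-monoˡ-≤ (w * normSq k s″) (*-monoʳ-≤ i e≤e″))
            (≤-reflexive (sym (*-distribʳ-+ (normSq k s″) i w)))) (below-Q s″)
        ... | inj₂ e″≤e = ≤-<-trans (≤-trans (+-monoʳ-≤ (i * normSq k s) (*-monoʳ-≤ w e″≤e))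
            (≤-reflexive (sym (*-distribʳ-+ (normSq k s) i w)))) (below-Q s)
        separate = digits-unique {(i + w) * spread k s′} {i * spread k s + w * spread k s″} (below-Q s′) below-Q″
          (+-cancelˡ-≡ ((i + w) * M) _ _ (trans (sym (expand₁ (i + w) M (spread k s′) Q (normSq k s′)))
            (trans eq (expand₂ i w M (spread k s) (spread k s″) Q (normSq k s) (normSq k s″)))))
        weighted≡0 : i * w * distSq k s s″ ≡ 0
        weighted≡0 = +-cancelˡ-≡ ((i + w) * ((i + w) * normSq k s′)) _ _
          (trans (normSq-mean {i = i} {w} i+w<t tq≤b k {s} {s′} {s″} (proj₁ separate))
          (trans (cong ((i + w) *_) (sym (proj₂ separate))) (sym (+-identityʳ _))))
        distSq≡0 : distSq k s s″ ≡ 0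
        distSq≡0 = m*n≡0⇒n≡0 (i * w) _ {{m*n≢0 i w {{>-nonZero 0<i}} {{>-nonZero 0<w}}}} weighted≡0
          where
          m*n≡0⇒n≡0 : ∀ m n .{{_ : NonZero m}} → m * n ≡ 0 → n ≡ 0
          m*n≡0⇒n≡0 m n eq = *-cancelˡ-≡ n 0 m (trans eq (sym (*-zeroʳ m)))

  -- Counting the 1s of a matrix

  Σ< : ℕ → (ℕ → ℕ) → ℕ
  Σ< zero    f = 0
  Σ< (suc n) f = Σ< n f + f n

  Σ<-head : ∀ n f → Σ< (suc n) f ≡ f 0 + Σ< n (f ∘ suc)
  Σ<-head zero    f = sym (+-identityʳ (f 0))
  Σ<-head (suc n) f = trans (cong (_+ f (suc n)) (Σ<-head n f)) (+-assoc (f 0) _ _)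

  Σ<-cong : ∀ n {f g} → (∀ i → f i ≡ g i) → Σ< n f ≡ Σ< n g
  Σ<-cong zero    f≗g = refl
  Σ<-cong (suc n) f≗g = cong₂ _+_ (Σ<-cong n f≗g) (f≗g n)

  Σ<-zero : ∀ n → Σ< n (λ _ → 0) ≡ 0
  Σ<-zero zero    = refl
  Σ<-zero (suc n) = cong (_+ 0) (Σ<-zero n)

  Σ<-+ : ∀ n f g → Σ< n (λ i → f i + g i) ≡ Σ< n f + Σ< n g
  Σ<-+ zero    f g = refl
  Σ<-+ (suc n) f g = trans (cong (_+ (f n + g n)) (Σ<-+ n f g)) (interchange (Σ< n f) (Σ< n g) (f n) (g n))
    where
    interchange : ∀ a b c d → a + b + (c + d) ≡ (a + c) + (b + d)
    interchange = solve-∀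

  Σ<-swap : ∀ m n (f : ℕ → ℕ → ℕ) → Σ< m (λ i → Σ< n (f i)) ≡ Σ< n (λ j → Σ< m (λ i → f i j))
  Σ<-swap zero    n f = sym (Σ<-zero n)
  Σ<-swap (suc m) n f = trans (cong (_+ Σ< n (f m)) (Σ<-swap m n f))
    (sym (Σ<-+ n (λ j → Σ< m (λ i → f i j)) (f m)))

  Σ<-monoˡ-≤ : ∀ f {m n} → m ≤ n → Σ< m f ≤ Σ< n f
  Σ<-monoˡ-≤ f {m} {n} m≤n = subst (λ k → Σ< m f ≤ Σ< k f) (m+[n∸m]≡n m≤n) (go (n ∸ m))
    where
    go : ∀ k → Σ< m f ≤ Σ< (m + k) f
    go zero    = ≤-reflexive (cong (λ k → Σ< k f) (sym (+-identityʳ m)))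
    go (suc k) rewrite +-suc m k = ≤-trans (go k) (m≤m+n _ _)

  Σ<-≥-const : ∀ n {f c} → (∀ {i} → i < n → c ≤ f i) → n * c ≤ Σ< n f
  Σ<-≥-const zero    c≤f = z≤n
  Σ<-≥-const (suc n) {f} {c} c≤f = ≤-trans (≤-reflexive (+-comm c (n * c)))
    (+-mono-≤ (Σ<-≥-const n (c≤f ∘ m<n⇒m<1+n)) (c≤f (n<1+n n)))

  -- The values of `g` are distinct positions, each contributing at least 1. The largest is split
  -- off and bounds the range of the others.
  Σ<-≥-positives : ∀ S {n f} g → StrictlyMonotoneBelow S g →
    (∀ {s} → s < S → g s < n) → (∀ {s} → s < S → 1 ≤ f (g s)) → S ≤ Σ< n f
  Σ<-≥-positives zero    g mono g<n f≥1 = z≤n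
  Σ<-≥-positives (suc S) {n} {f} g mono g<n f≥1 = begin
    suc S                     ≡⟨ +-comm 1 S ⟩
    S + 1                     ≤⟨ +-mono-≤ (Σ<-≥-positives S g (λ s<s′ s′<S → mono s<s′ (m<n⇒m<1+n s′<S))
                                   (λ s<S → mono s<S (n<1+n S)) (f≥1 ∘ m<n⇒m<1+n)) (f≥1 (n<1+n S)) ⟩
    Σ< (g S) f + f (g S)      ≤⟨ Σ<-monoˡ-≤ f (g<n (n<1+n S)) ⟩
    Σ< n f                    ∎
    where open ≤-Reasoning

  indicator : Bool → ℕ
  indicator b = if b then 1 else 0

  fromPredicate : ∀ n → (ℕ → ℕ → Bool) → Matrix n n
  fromPredicate n b = tabulate λ i → tabulate λ j → b (toℕ i) (toℕ j)

  entry-fromPredicate : ∀ n b i j → entry (fromPredicate n b) i j ≡ b (toℕ i) (toℕ j)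
  entry-fromPredicate n b i j = trans (cong (λ row → Vec.lookup row j) (Vec.lookup∘tabulate _ i)) (Vec.lookup∘tabulate _ j)

  sum-tabulate : ∀ n f → Vec.sum (tabulate {n = n} (f ∘ toℕ)) ≡ Σ< n f
  sum-tabulate zero    f = refl
  sum-tabulate (suc n) f = trans (cong (f 0 +_) (sum-tabulate n (f ∘ suc))) (sym (Σ<-head n f))

  countᵇ-tabulate : ∀ n f → countᵇ id (tabulate {n = n} (f ∘ toℕ)) ≡ Σ< n (indicator ∘ f)
  countᵇ-tabulate zero    f = refl
  countᵇ-tabulate (suc n) f = trans (head (f 0)) (trans (cong (indicator (f 0) +_) (countᵇ-tabulate n (f ∘ suc)))
                                    (sym (Σ<-head n (indicator ∘ f))))
    where
    head : ∀ b {k} → (if b then suc else id) k ≡ indicator b + k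
    head false = refl
    head true  = refl

  weight-fromPredicate : ∀ n b → weight (fromPredicate n b) ≡ Σ< n λ i → Σ< n λ j → indicator (b i j)
  weight-fromPredicate n b = begin
    Vec.sum (Vec.map (countᵇ id) (fromPredicate n b))
        ≡⟨ cong Vec.sum (Vec.tabulate-∘ {n = n} (countᵇ id) λ i → tabulate {n = n} λ j → b (toℕ i) (toℕ j)) ⟨
    Vec.sum (tabulate {n = n} (λ i → countᵇ id (tabulate {n = n} (λ j → b (toℕ i) (toℕ j)))))
      ≡⟨ sum-tabulate n (λ i → countᵇ id (tabulate {n = n} (λ j → b i (toℕ j)))) ⟩
    Σ< n (λ i → countᵇ id (tabulate {n = n} (λ j → b i (toℕ j))))
      ≡⟨ Σ<-cong n (λ i → countᵇ-tabulate n (b i)) ⟩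
    (Σ< n λ i → Σ< n λ j → indicator (b i j))                 ∎
    where open ≡-Reasoning

  -- Here `g s j` is the row of the 1 numbered `s` in column `j`. The 1s are counted by columns,
  -- after exchanging the two sums.
  weight-≥ : ∀ {n S c} b (g : ℕ → ℕ → ℕ) → c ≤ n →
    (∀ {j} → j < c → StrictlyMonotoneBelow S (λ s → g s j)) →
    (∀ {s j} → s < S → j < c → g s j < n) →
    (∀ {s j} → s < S → j < c → b (g s j) j ≡ true) →
    c * S ≤ weight (fromPredicate n b)
  weight-≥ {n} {S} {c} b g c≤n mono g<n one = begin
    c * S                                       ≤⟨ Σ<-≥-const c (λ {j} j<c → Σ<-≥-positives S (λ s → g s j) (mono j<c)
                                                     (λ s<S → g<n s<S j<c) (λ s<S → ≤-reflexive (cong indicator (sym (one s<S j<c))))) ⟩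
    Σ< c (λ j → Σ< n λ i → indicator (b i j))   ≤⟨ Σ<-monoˡ-≤ _ c≤n ⟩
    Σ< n (λ j → Σ< n λ i → indicator (b i j))   ≡⟨ Σ<-swap n n (λ i j → indicator (b i j)) ⟨
    Σ< n (λ i → Σ< n λ j → indicator (b i j))   ≡⟨ weight-fromPredicate n b ⟨
    weight (fromPredicate n b)                  ∎
    where open ≤-Reasoning

  -- Alternation within one level

  -- Equality in the first (second) alternative can only occur for i beyond (before)
  -- the threshold i = V (D - D′) / D, which is not attained.  Hence i grows at every
  -- step, and once more when it crosses the threshold.
  module _ {τ V D D′ : ℕ} (V≤τ : V ≤ τ) (0<V : 0 < V) (D′<D : D′ < D)
    (no-tie : ∀ {i w} → i + w ≡ V → D * w ≢ D′ * V)
    (i w : ℕ → ℕ) (i₀≡0 : i 0 ≡ 0)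
    (rise : ∀ {k} → k ≤ τ → i k + w k < V ⊎ (i k + w k ≡ V × D * w k ≤ D′ * V))
    (fall : ∀ {k} → k < τ → V < i (suc k) + w k ⊎ (i (suc k) + w k ≡ V × D′ * V ≤ D * w k))
    where

    private
      -- The two sides of the threshold, cleared of denominator and subtraction.
      Early Late : ℕ → Set
      Early j = D′ * V + D * j < D * V
      Late  j = D * V < D′ * V + D * j

      split : ∀ {j x} → j + x ≡ V → D * V ≡ D * x + D * j
      split {j} {x} refl = trans (*-distribˡ-+ D j x) (+-comm (D * j) (D * x))

      rise-early : ∀ {k} → k ≤ τ → Early (i k) → i k + w k < V
      rise-early {k} k≤τ early with rise k≤τ
      ... | inj₁ lt = lt
      ... | inj₂ (eq , le) = contradiction
        (≤-trans (≤-reflexive (split eq)) (+-monoˡ-≤ (D * i k) le)) (<⇒≱ early)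

      rise-any : ∀ {k} → k ≤ τ → i k + w k ≤ V
      rise-any k≤τ with rise k≤τ
      ... | inj₁ lt = <⇒≤ lt
      ... | inj₂ (eq , _) = ≤-reflexive eq

      fall-late : ∀ {k} → k < τ → Late (i (suc k)) → V < i (suc k) + w k
      fall-late {k} k<τ late with fall k<τ
      ... | inj₁ lt = lt
      ... | inj₂ (eq , le) = contradiction
        (≤-trans (+-monoˡ-≤ (D * i (suc k)) le) (≤-reflexive (sym (split eq)))) (<⇒≱ late)

      fall-any : ∀ {k} → k < τ → V ≤ i (suc k) + w k
      fall-any k<τ with fall k<τ
      ... | inj₁ lt = <⇒≤ lt
      ... | inj₂ (eq , _) = ≤-reflexive (sym eq)

      early⊎late : ∀ j → Early j ⊎ Late j
      early⊎late j with <-cmp (D′ * V + D * j) (D * V)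
      ... | tri< lt _ _ = inj₁ lt
      ... | tri> _ _ gt = inj₂ gt
      ... | tri≈ _ eq _ = contradiction tie (no-tie (m+[n∸m]≡n j≤V))
        where
        j≤V : j ≤ V
        j≤V = *-cancelˡ-≤ D {{>-nonZero (≤-<-trans z≤n D′<D)}}
                (≤-trans (m≤n+m (D * j) (D′ * V)) (≤-reflexive eq))
        tie : D * (V ∸ j) ≡ D′ * V
        tie = +-cancelʳ-≡ (D * j) _ _ (trans (sym (split (m+[n∸m]≡n j≤V))) (sym eq))

      invariant : ∀ k → k ≤ τ → (Early (i k) × k ≤ i k) ⊎ (Late (i k) × k < i k)
      invariant zero _ = inj₁ (subst Early (sym i₀≡0) early₀ , z≤n)
        where
        early₀ : Early 0
        early₀ = subst (_< D * V) (sym (trans (cong (D′ * V +_) (*-zeroʳ D)) (+-identityʳ _)))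
          (*-monoˡ-< V {{>-nonZero 0<V}} D′<D)
      invariant (suc k) k<τ with invariant k (<⇒≤ k<τ) | early⊎late (i (suc k))
      ... | inj₁ (early , k≤i) | inj₁ early⁺ = inj₁ (early⁺ , ≤-<-trans k≤i
        (+-cancelʳ-< (w k) _ _ (<-≤-trans (rise-early (<⇒≤ k<τ) early) (fall-any k<τ))))
      -- At the crossing `i k + w k < V < i (suc k) + w k`, so `i` grows by at least 2.
      ... | inj₁ (early , k≤i) | inj₂ late⁺ = inj₂ (late⁺ , ≤-<-trans (s≤s k≤i)
        (+-cancelʳ-< (w k) _ _ (≤-<-trans (rise-early (<⇒≤ k<τ) early) (fall-late k<τ late⁺))))
      ... | inj₂ (late , k<i) | inj₂ late⁺ = inj₂ (late⁺ , ≤-<-trans k<i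
        (+-cancelʳ-< (w k) _ _ (≤-<-trans (rise-any (<⇒≤ k<τ)) (fall-late k<τ late⁺))))
      -- `i` never decreases, so it cannot return below the threshold.
      ... | inj₂ (late , k<i) | inj₁ early⁺ = contradiction early⁺ (<⇒≯ (<-≤-trans late
        (+-monoʳ-≤ (D′ * V) (*-monoʳ-≤ D (+-cancelʳ-≤ (w k) _ _ (≤-trans (rise-any (<⇒≤ k<τ)) (fall-any k<τ)))))))

    alternation-⊥ : ⊥
    alternation-⊥ with invariant τ ≤-refl
    ... | inj₁ (early , τ≤i) = <⇒≱ (≤-<-trans (≤-trans τ≤i (m≤m+n (i τ) (w τ))) (rise-early ≤-refl early)) V≤τ
    ... | inj₂ (_ , τ<i) = <⇒≱ (<-≤-trans τ<i (≤-trans (m≤m+n (i τ) (w τ)) (rise-any ≤-refl))) V≤τ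

  -- At one level a column is the line with value p + A * v at time A; the row determines A.
  line : (t : ℕ) .{{_ : NonZero t}} → ℕ → ℕ → ℕ
  line t A c = c / t + A * (c % t)

  -- Lines that agree at time `A` trade slope for starting value at the rate `A`.
  slide : ∀ {A p p₀ v v₀} → 0 < A → p + A * v ≡ p₀ + A * v₀ → p₀ ≤ p →
          v ≤ v₀ × p ≡ p₀ + A * (v₀ ∸ v)
  slide {A} {p} {p₀} {v} {v₀} 0<A eq p₀≤p = v≤v₀ , +-cancelʳ-≡ (A * v) _ _ (begin
    p + A * v                      ≡⟨ eq ⟩
    p₀ + A * v₀                    ≡⟨ cong (λ x → p₀ + A * x) (m∸n+n≡m v≤v₀) ⟨
    p₀ + A * (v₀ ∸ v + v)          ≡⟨ regroup p₀ A (v₀ ∸ v) v ⟩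
    p₀ + A * (v₀ ∸ v) + A * v      ∎)
    where
    open ≡-Reasoning
    regroup : ∀ p A x v → p + A * (x + v) ≡ p + A * x + A * v
    regroup = solve-∀
    v≤v₀ : v ≤ v₀
    v≤v₀ = *-cancelˡ-≤ A {{>-nonZero 0<A}} (+-cancelˡ-≤ p₀ _ _
      (≤-trans (+-monoˡ-≤ (A * v) p₀≤p) (≤-reflexive eq)))

  regroup-times : ∀ A D i w → A * i + (A + D) * w ≡ A * (i + w) + D * w
  regroup-times = solve-∀

  -- The inequality reads `A * (i + w) + D * w ≤ A * V + D′ * V`. Since `D′ * V < D * t ≤ A`, the
  -- last summand cannot make up for `i + w` exceeding `V`; the small terms decide only when these
  -- are equal.
  rise-dichotomy : ∀ {A D D′ V i w t} → D * t ≤ A → D′ < D → V < t →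
    A * i + (A + D) * w ≤ (A + D′) * V → i + w < V ⊎ (i + w ≡ V × D * w ≤ D′ * V)
  rise-dichotomy {A} {D} {D′} {V} {i} {w} {t} Dt≤A D′<D V<t le with <-cmp (i + w) V
  ... | tri< lt _ _ = inj₁ lt
  ... | tri≈ _ refl _ = inj₂ (refl , +-cancelˡ-≤ (A * (i + w)) _ _ (subst₂ _≤_ (regroup-times A D i w) (*-distribʳ-+ (i + w) A D′) le))
  ... | tri> _ _ V<i+w = contradiction (+-cancelˡ-≤ (A * V) _ _ (begin
    A * V + A                ≡⟨ trans (+-comm (A * V) A) (sym (*-suc A V)) ⟩
    A * suc V                ≤⟨ *-monoʳ-≤ A V<i+w ⟩
    A * (i + w)              ≤⟨ m≤m+n (A * (i + w)) (D * w) ⟩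
    A * (i + w) + D * w      ≡⟨ regroup-times A D i w ⟨
    A * i + (A + D) * w      ≤⟨ le ⟩
    (A + D′) * V             ≡⟨ *-distribʳ-+ V A D′ ⟩
    A * V + D′ * V           ∎)) (<⇒≱ (<-≤-trans (*-mono-< D′<D V<t) Dt≤A))
    where
    open ≤-Reasoning

  -- The mirror image: now `D * w < D * t ≤ A` is the summand too small to make up for a deficit of
  -- `i + w`.
  fall-dichotomy : ∀ {A D D′ V i w t} → D * t ≤ A → 0 < D → w < t →
    (A + D′) * V ≤ A * i + (A + D) * w → V < i + w ⊎ (i + w ≡ V × D′ * V ≤ D * w)
  fall-dichotomy {A} {D} {D′} {V} {i} {w} {t} Dt≤A 0<D w<t le with <-cmp V (i + w)
  ... | tri< lt _ _ = inj₁ lt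
  ... | tri≈ _ refl _ = inj₂ (refl , +-cancelˡ-≤ (A * (i + w)) _ _ (subst₂ _≤_ (*-distribʳ-+ (i + w) A D′) (regroup-times A D i w) le))
  ... | tri> _ _ i+w<V = contradiction (+-cancelˡ-≤ (A * (i + w)) _ _ (begin
    A * (i + w) + A          ≡⟨ trans (+-comm (A * (i + w)) A) (sym (*-suc A (i + w))) ⟩
    A * suc (i + w)          ≤⟨ *-monoʳ-≤ A i+w<V ⟩
    A * V                    ≤⟨ *-monoˡ-≤ V (m≤m+n A D′) ⟩
    (A + D′) * V             ≤⟨ le ⟩
    A * i + (A + D) * w      ≡⟨ regroup-times A D i w ⟩
    A * (i + w) + D * w      ∎)) (<⇒≱ (<-≤-trans (*-monoʳ-< D {{>-nonZero 0<D}} w<t) Dt≤A))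
    where
    open ≤-Reasoning

  -- y and z are interleaved: y 0 ≤ z 0 ≤ y 1 ≤ z 1 ≤ … ≤ y τ ≤ z τ.
  record Alternating (_∼_ : ℕ → ℕ → Set) (τ : ℕ) (y z : ℕ → ℕ) : Set where
    field
      up   : ∀ {k} → k ≤ τ → y k ∼ z k
      down : ∀ {k} → k < τ → z k ∼ y (suc k)

  open Alternating

  mapAlternating : ∀ {_∼_ _≈_ : ℕ → ℕ → Set} {f : ℕ → ℕ} → (∀ {m n} → m ∼ n → f m ≈ f n) →
    ∀ {τ y z} → Alternating _∼_ τ y z → Alternating _≈_ τ (f ∘ y) (f ∘ z)
  mapAlternating f alt = record { up = f ∘ up alt ; down = f ∘ down alt }

  module _ {τ : ℕ} {y z : ℕ → ℕ} (alt : Alternating _≤_ τ y z) where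

    from-first : ∀ {k} → k ≤ τ → y 0 ≤ y k
    from-first {zero}  _   = ≤-refl
    from-first {suc k} k<τ = ≤-trans (from-first (<⇒≤ k<τ)) (≤-trans (up alt (<⇒≤ k<τ)) (down alt k<τ))

    to-last : ∀ {k} → k ≤ τ → z k ≤ z τ
    to-last {k} k≤τ = go (τ ∸ k) (m∸n+n≡m k≤τ)
      where
      go : ∀ j {k} → j + k ≡ τ → z k ≤ z τ
      go zero    refl = ≤-refl
      go (suc j) {k} eq = ≤-trans (≤-trans (down alt k<τ) (up alt k<τ)) (go j (trans (+-suc j k) eq))
        where
        k<τ : k < τ
        k<τ = ≤-trans (s≤s (m≤n+m k j)) (≤-reflexive eq)

    first≤last : y 0 ≤ z τ
    first≤last = ≤-trans (up alt z≤n) (to-last z≤n)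

    constant : y 0 ≡ z τ → ∀ {k} → k ≤ τ → y k ≡ y 0 × z k ≡ z τ
    constant y₀≡zτ k≤τ =
      ≤-antisym (≤-trans (up alt k≤τ) (≤-trans (to-last k≤τ) (≤-reflexive (sym y₀≡zτ)))) (from-first k≤τ) ,
      ≤-antisym (to-last k≤τ) (≤-trans (≤-reflexive (sym y₀≡zτ)) (≤-trans (from-first k≤τ) (up alt k≤τ)))

  module _ {τ A D D′ : ℕ} (0<D′ : 0 < D′) (D′<D : D′ < D) (Dt≤A : D * suc τ ≤ A)
    (noMean : ∀ {i w} → 0 < i → 0 < w → i + w < suc τ → (i + w) * (A + D′) ≢ i * A + w * (A + D))
    {y z : ℕ → ℕ} (alt : Alternating _≤_ τ y z)
    (meet-y : ∀ {k} → k ≤ τ → line (suc τ) A (y k) ≡ line (suc τ) A (y 0))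
    (meet-z : ∀ {k} → k ≤ τ → line (suc τ) (A + D) (z k) ≡ line (suc τ) (A + D) (z τ))
    (meet : line (suc τ) (A + D′) (y 0) ≡ line (suc τ) (A + D′) (z τ))
    where

    private
      t : ℕ
      t = suc τ

      p v : ℕ → ℕ
      p c = c / t
      v c = c % t

      p-alt : Alternating _≤_ τ (p ∘ y) (p ∘ z)
      p-alt = mapAlternating (/-monoˡ-≤ t) alt

      -- Slope drops that measure starting values: these rise by `(A + D′) * V` from `y 0` to `z τ`,
      -- by `A * i k` from `y 0` to `y k`, and by `(A + D) * w k` from `z k` to `z τ`.
      V : ℕ
      V = v (y 0) ∸ v (z τ)

      i w : ℕ → ℕ
      i k = v (y 0) ∸ v (y k)
      w k = v (z k) ∸ v (z τ)

      0<D : 0 < D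
      0<D = <-trans 0<D′ D′<D

      0<A : 0 < A
      0<A = <-≤-trans (*-mono-< 0<D z<s) Dt≤A

      0<A+ : ∀ {x} → 0 < A + x
      0<A+ = <-≤-trans 0<A (m≤m+n A _)

      slide-V = slide {A + D′} 0<A+ (sym meet) (first≤last p-alt)
      slide-y = λ {k} (k≤τ : k ≤ τ) → slide {A} 0<A (meet-y k≤τ) (from-first p-alt k≤τ)
      slide-z = λ {k} (k≤τ : k ≤ τ) → slide {A + D} 0<A+ (sym (meet-z k≤τ)) (to-last p-alt k≤τ)

      -- This is `p (y k) ≤ p (z k)` in terms of slope drops; `fall` is `p (z k) ≤ p (y (suc k))`.
      rise : ∀ {k} → k ≤ τ → A * i k + (A + D) * w k ≤ (A + D′) * V
      rise {k} k≤τ = +-cancelˡ-≤ (p (y 0)) _ _ (begin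
        p (y 0) + (A * i k + (A + D) * w k)  ≡⟨ +-assoc (p (y 0)) _ _ ⟨
        p (y 0) + A * i k + (A + D) * w k    ≡⟨ cong (_+ (A + D) * w k) (proj₂ (slide-y k≤τ)) ⟨
        p (y k) + (A + D) * w k              ≤⟨ +-monoˡ-≤ _ (up p-alt k≤τ) ⟩
        p (z k) + (A + D) * w k              ≡⟨ proj₂ (slide-z k≤τ) ⟨
        p (z τ)                              ≡⟨ proj₂ slide-V ⟩
        p (y 0) + (A + D′) * V               ∎)
        where open ≤-Reasoning

      fall : ∀ {k} → k < τ → (A + D′) * V ≤ A * i (suc k) + (A + D) * w k
      fall {k} k<τ = +-cancelˡ-≤ (p (y 0)) _ _ (begin
        p (y 0) + (A + D′) * V                     ≡⟨ proj₂ slide-V ⟨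
        p (z τ)                                    ≡⟨ proj₂ (slide-z (<⇒≤ k<τ)) ⟩
        p (z k) + (A + D) * w k                    ≤⟨ +-monoˡ-≤ _ (down p-alt k<τ) ⟩
        p (y (suc k)) + (A + D) * w k              ≡⟨ cong (_+ (A + D) * w k) (proj₂ (slide-y k<τ)) ⟩
        p (y 0) + A * i (suc k) + (A + D) * w k    ≡⟨ +-assoc (p (y 0)) _ _ ⟩
        p (y 0) + (A * i (suc k) + (A + D) * w k)  ∎)
        where open ≤-Reasoning

      V<t : V < t
      V<t = ≤-<-trans (m∸n≤m (v (y 0)) (v (z τ))) (m%n<n (y 0) t)

      -- A tie makes `A + D′` the mean of `A` and `A + D` with weights `i` and `w`. If a weight is
      -- 0, it forces `D′` = `D` or `D′ * V` = 0.
      no-tie : 0 < V → ∀ {i w} → i + w ≡ V → D * w ≢ D′ * V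
      no-tie 0<V {zero} {w} refl = <⇒≢ (*-monoˡ-< w {{>-nonZero 0<V}} D′<D) ∘ sym
      no-tie 0<V {i} {zero} eq tie = <⇒≢ (*-mono-< 0<D′ 0<V) (trans (sym (*-zeroʳ D)) tie)
      no-tie 0<V {i@(suc _)} {w@(suc _)} eq tie =
        noMean {i} {w} z<s z<s (subst (_< t) (sym eq) V<t) (begin
          (i + w) * (A + D′)        ≡⟨ expand i w A D′ ⟩
          (i + w) * A + D′ * (i + w)  ≡⟨ cong (λ x → (i + w) * A + D′ * x) eq ⟩
          (i + w) * A + D′ * V      ≡⟨ cong ((i + w) * A +_) tie ⟨
          (i + w) * A + D * w       ≡⟨ collect i w A D ⟩
          i * A + w * (A + D)       ∎)
        where
        open ≡-Reasoning
        expand : ∀ i w A D → (i + w) * (A + D) ≡ (i + w) * A + D * (i + w)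
        expand = solve-∀
        collect : ∀ i w A D → (i + w) * A + D * w ≡ i * A + w * (A + D)
        collect = solve-∀

    -- If `V` is 0, the first and last lines are parallel and meet, so they coincide. A positive `V`
    -- is below `t`, too small a slope drop for so many alternations.
    constant-within-level : y 0 ≡ z τ
    constant-within-level with V in V-eq
    ... | zero = /-%-injective t
      (trans (sym (+-identityʳ _)) (trans (cong (p (y 0) +_) (sym (*-zeroʳ (A + D′))))
          (trans (cong (λ x → p (y 0) + (A + D′) * x) (sym V-eq)) (sym (proj₂ slide-V)))))
      (≤-antisym (m∸n≡0⇒m≤n V-eq) (proj₁ slide-V))
    ... | suc _ = ⊥-elim (alternation-⊥ (≤-pred V<t) 0<V D′<D (no-tie 0<V) i w (n∸n≡0 (v (y 0)))
      (λ k≤τ → rise-dichotomy Dt≤A D′<D V<t (rise k≤τ))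
      (λ {k} k<τ → fall-dichotomy Dt≤A 0<D (≤-<-trans (m∸n≤m (v (z k)) (v (z τ))) (m%n<n (z k) t)) (fall k<τ)))
      where
      0<V : 0 < V
      0<V = subst (0 <_) (sym V-eq) z<s

  level-constant : ∀ {τ A A′ A″} (let t = suc τ) → A < A′ → A′ < A″ → (A″ ∸ A) * t ≤ A →
    (∀ {i w} → 0 < i → 0 < w → i + w < t → (i + w) * A′ ≢ i * A + w * A″) →
    ∀ {y z} → Alternating _≤_ τ y z →
    (∀ {k} → k ≤ τ → line t A (y k) ≡ line t A (y 0)) →
    (∀ {k} → k ≤ τ → line t A″ (z k) ≡ line t A″ (z τ)) →
    line t A′ (y 0) ≡ line t A′ (z τ) → y 0 ≡ z τ
  level-constant {A = A} {A′} {A″} A<A′ A′<A″ steep noMean alt meet-y meet-z meet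
    with A′ ∸ A | m<n⇒0<n∸m A<A′ | m+[n∸m]≡n (<⇒≤ A<A′) | A″ ∸ A | m+[n∸m]≡n (<⇒≤ (<-trans A<A′ A′<A″))
  ... | _ | 0<D′ | refl | _ | refl =
    constant-within-level 0<D′ (+-cancelˡ-< A _ _ A′<A″) steep noMean alt meet-y meet-z meet

  -- The incidence matrix

  does≡true⇒ : ∀ {A : Set} (A? : Dec A) → does A? ≡ true → A
  does≡true⇒ (yes a) _ = a

  -- A column consists of d digits c = p * t + v (with p < P, v < t) and a remainder below K;
  -- a row consists of a time index s < S, d digits below R, and a remainder below K.
  module Lines (τ : ℕ) (h : ℕ → ℕ) (S H P R K : ℕ) .{{_ : NonZero P}} .{{_ : NonZero K}}
    (mono   : StrictlyMonotoneBelow S h)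
    (h<H    : ∀ {s} → s < S → h s < H)
    (steep  : ∀ {s s″} → s < S → s″ < S → (h s″ ∸ h s) * suc τ ≤ h s)
    (noMean : NoWeightedMean (suc τ) S h)
    (P+Ht≤R : P + H * suc τ ≤ R)
    where

    private
      t : ℕ
      t = suc τ

    Rows Cols : ℕ → ℕ
    Rows d = R ^ d * K
    Cols d = (P * t) ^ d * K

    private
      Cols≢0 : ∀ d → NonZero (Cols d)
      Cols≢0 d = m*n≢0 ((P * t) ^ d) K {{m^n≢0 (P * t) d {{m*n≢0 P t}}}}

    top rest : ℕ → ℕ → ℕ
    top  d j = _/_ j (Cols d) {{Cols≢0 d}}
    rest d j = _%_ j (Cols d) {{Cols≢0 d}}

    -- The digits are the values of the `d` lines at time `h s`. The remainder is copied unchanged;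
    -- it multiplies the size by `K`, so that any large `n` can be approached.
    meetingRow : ℕ → ℕ → ℕ → ℕ
    meetingRow zero    s j = j
    meetingRow (suc d) s j = line t (h s) (top d j) * Rows d + meetingRow d s (rest d j)

    private
      rest-< : ∀ d j → rest d j < Cols d
      rest-< d j = m%n<n j (Cols d) {{Cols≢0 d}}

      top-< : ∀ d {j} → j < Cols (suc d) → top d j < P * t
      top-< d {j} j< = m<n*o⇒m/o<n {{Cols≢0 d}} (subst (j <_) (*-assoc (P * t) ((P * t) ^ d) K) j<)

      line-< : ∀ {s c} → s < S → c < P * t → line t (h s) c < R
      line-< {s} {c} s<S c< = <-≤-trans
        (+-mono-<-≤ (m<n*o⇒m/o<n c<) (*-mono-≤ (<⇒≤ (h<H s<S)) (m%n≤n c t))) P+Ht≤R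

    meetingRow-< : ∀ d {s j} → s < S → j < Cols d → meetingRow d s j < Rows d
    meetingRow-< zero    s<S j<K = j<K
    meetingRow-< (suc d) {s} {j} s<S j< = digits-< (line-< s<S (top-< d j<))
      (meetingRow-< d s<S (rest-< d j)) (≤-reflexive (sym (*-assoc R (R ^ d) K)))

    -- Induction on the levels. Leading digits alternate weakly, so `level-constant` makes them all
    -- equal and the strict alternation passes to the remainders. With no level left, the middle row
    -- yields `y 0` = `z τ`, against `y 0 < z τ`.
    no-alternation : ∀ d {s s′ s″ y z} → s < s′ → s′ < s″ → s″ < S → Alternating _<_ τ y z →
      (∀ {k} → k ≤ τ → meetingRow d s (y k) ≡ meetingRow d s (y 0)) →
      (∀ {k} → k ≤ τ → meetingRow d s″ (z k) ≡ meetingRow d s″ (z τ)) →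
      meetingRow d s′ (y 0) ≢ meetingRow d s′ (z τ)
    no-alternation zero s<s′ s′<s″ s″<S alt meet-y meet-z =
      <⇒≢ (<-≤-trans (up alt z≤n) (to-last (mapAlternating {f = id} <⇒≤ alt) z≤n))
    no-alternation (suc d) {s} {s′} {s″} {y} {z} s<s′ s′<s″ s″<S alt meet-y meet-z meet =
      no-alternation d s<s′ s′<s″ s″<S rest-alt
        (λ k≤τ → proj₂ (separate s<S (meet-y k≤τ)))
        (λ k≤τ → proj₂ (separate s″<S (meet-z k≤τ)))
        (proj₂ (separate s′<S meet))
      where
      s′<S : s′ < S
      s′<S = <-trans s′<s″ s″<S
      s<S : s < S
      s<S = <-trans s<s′ s′<S
      separate : ∀ {s j j′} → s < S → meetingRow (suc d) s j ≡ meetingRow (suc d) s j′ →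
        line t (h s) (top d j) ≡ line t (h s) (top d j′) × meetingRow d s (rest d j) ≡ meetingRow d s (rest d j′)
      separate {j = j} {j′} s<S = digits-unique
        (meetingRow-< d s<S (rest-< d j)) (meetingRow-< d s<S (rest-< d j′))
      top-alt : Alternating _≤_ τ (top d ∘ y) (top d ∘ z)
      top-alt = mapAlternating (λ m<n → /-monoˡ-≤ (Cols d) {{Cols≢0 d}} (<⇒≤ m<n)) alt
      top-equal : top d (y 0) ≡ top d (z τ)
      top-equal = level-constant (mono s<s′ s′<S) (mono s′<s″ s″<S) (steep s<S s″<S)
        (λ 0<i 0<w i+w<t → noMean 0<i 0<w i+w<t (<-trans s<s′ s′<s″) s′<S s″<S) top-alt
        (λ k≤τ → proj₁ (separate s<S (meet-y k≤τ)))
        (λ k≤τ → proj₁ (separate s″<S (meet-z k≤τ)))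
        (proj₁ (separate s′<S meet))
      top-y : ∀ {k} → k ≤ τ → top d (y k) ≡ top d (y 0)
      top-y k≤τ = proj₁ (constant top-alt top-equal k≤τ)
      top-z : ∀ {k} → k ≤ τ → top d (z k) ≡ top d (y 0)
      top-z k≤τ = trans (proj₂ (constant top-alt top-equal k≤τ)) (sym top-equal)
      rest-alt : Alternating _<_ τ (rest d ∘ y) (rest d ∘ z)
      rest-alt = record
        { up   = λ k≤τ → /≡⇒%< (Cols d) {{Cols≢0 d}} (up alt k≤τ) (trans (top-y k≤τ) (sym (top-z k≤τ)))
        ; down = λ k<τ → /≡⇒%< (Cols d) {{Cols≢0 d}} (down alt k<τ) (trans (top-z (<⇒≤ k<τ)) (sym (top-y k<τ)))
        }

    -- Rows ordered by time, and freeness of the matrix.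

    rowIndex : ℕ → ℕ → ℕ → ℕ
    rowIndex d s j = s * Rows d + meetingRow d s j

    Incident : ℕ → ℕ → ℕ → Set
    Incident d i j = j < Cols d × ∃ λ s → s < S × i ≡ rowIndex d s j

    incident? : ∀ d i j → Dec (Incident d i j)
    incident? d i j = (j <? Cols d) ×-dec anyUpTo? (λ s → i ≟ rowIndex d s j) S

    incidenceMatrix : ∀ d n → Matrix n n
    incidenceMatrix d n = fromPredicate n (λ i j → does (incident? d i j))

    weight-incidenceMatrix : ∀ d {n} → S * Rows d ≤ n → Cols d ≤ n → Cols d * S ≤ weight (incidenceMatrix d n)
    weight-incidenceMatrix d rows≤n cols≤n = weight-≥ (λ i j → does (incident? d i j)) (rowIndex d) cols≤n
      (λ {j} j< {s} {s′} s<s′ s′<S → leading-digit-< (meetingRow d s′ j) s<s′ (meetingRow-< d (<-trans s<s′ s′<S) j<))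
      (λ {s} {j} s<S j< → digits-< s<S (meetingRow-< d s<S j<) rows≤n)
      (λ {s} {j} s<S j< → dec-true (incident? d (rowIndex d s j) j) (j< , s , s<S , refl))

    same-row : ∀ {d i j j′} ((_ , s , _) : Incident d i j) ((_ , s′ , _) : Incident d i j′) →
               s′ ≡ s × meetingRow d s j′ ≡ meetingRow d s j
    same-row {d} (j< , s , s<S , eq) (j′< , s′ , s′<S , eq′)
      with digits-unique {s} {s′} (meetingRow-< d s<S j<) (meetingRow-< d s′<S j′<) (trans (sym eq) eq′)
    ... | refl , rows≡ = refl , sym rows≡

    -- At each time a column meets only one row.
    time-< : ∀ {d i i′ j} ((_ , s , _) : Incident d i j) ((_ , s′ , _) : Incident d i′ j) → i < i′ → s < s′
    time-< {d} {j = j} (j< , s , s<S , refl) (_ , s′ , s′<S , refl) i<i′ with <-cmp s s′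
    ... | tri< s<s′ _ _ = s<s′
    ... | tri≈ _ refl _ = contradiction i<i′ (<-irrefl refl)
    ... | tri> _ _ s′<s = contradiction i<i′ (<-asym (leading-digit-< (meetingRow d s j) s′<s (meetingRow-< d s′<S j<)))

    -- The two 1s of the middle row order the times: column `y 0` meets rows `i` and `i′`, and
    -- column `z τ` meets rows `i′` and `i″`.
    no-alternating-rows : ∀ d {i i′ i″ y z} → i < i′ → i′ < i″ → Alternating _<_ τ y z →
      (∀ {k} → k ≤ τ → Incident d i (y k)) → (∀ {k} → k ≤ τ → Incident d i″ (z k)) →
      Incident d i′ (y 0) → Incident d i′ (z τ) → ⊥
    no-alternating-rows d i<i′ i′<i″ alt inc-y inc-z first last =
      no-alternation d
        (time-< {d} (inc-y z≤n) first i<i′)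
        (subst (_< _) (proj₁ (same-row {d} first last)) (time-< {d} last (inc-z ≤-refl) i′<i″))
        (proj₁ (proj₂ (proj₂ (inc-z ≤-refl)))) alt
        (λ k≤τ → proj₂ (same-row {d} (inc-y z≤n) (inc-y k≤τ)))
        (λ k≤τ → proj₂ (same-row {d} (inc-z ≤-refl) (inc-z k≤τ)))
        (sym (proj₂ (same-row {d} first last)))

    incidenceMatrix-free : ∀ d n → Free (S₀ t) (incidenceMatrix d n)
    incidenceMatrix-free d n (ρ , κ , ρ-inc , κ-inc , ones) =
      no-alternating-rows d (ρ-inc {zero} {suc zero} z<s) (ρ-inc {suc zero} {suc (suc zero)} (s<s z<s))
        alt inc-y inc-z first last
      where
      pattern₀ : Fin 3
      pattern₀ = zero
      pattern₁ : Fin 3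
      pattern₁ = suc zero
      pattern₂ : Fin 3
      pattern₂ = suc (suc zero)
      -- Reduction modulo `2 * t` makes this total; it is applied to arguments below `2 * t`, which
      -- it preserves.
      col : ℕ → Fin (2 * t)
      col j = j mod (2 * t)
      toℕ-col : ∀ {j} → j < 2 * t → toℕ (col j) ≡ j
      toℕ-col {j} j< = trans (Fin.toℕ-fromℕ< (m%n<n j (2 * t))) (m<n⇒m%n≡m j<)
      col-< : ∀ {j j′} → j < j′ → j′ < 2 * t → toℕ (κ (col j)) < toℕ (κ (col j′))
      col-< j<j′ j′< = κ-inc (subst₂ _<_ (sym (toℕ-col (<-trans j<j′ j′<))) (sym (toℕ-col j′<)) j<j′)
      odd-< : ∀ {k} → k ≤ τ → suc (k * 2) < 2 * t
      odd-< {k} k≤τ = subst (suc (suc (k * 2)) ≤_) (*-comm t 2) (s≤s (s≤s (*-monoˡ-≤ 2 k≤τ)))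
      even-< : ∀ {k} → k ≤ τ → k * 2 < 2 * t
      even-< k≤τ = <-trans (n<1+n _) (odd-< k≤τ)
      -- Even pattern columns give `y` and odd ones `z`; `z τ` comes from the last column, 2t - 1.
      y z : ℕ → ℕ
      y k = toℕ (κ (col (k * 2)))
      z k = toℕ (κ (col (suc (k * 2))))
      alt : Alternating _<_ τ y z
      alt = record
        { up   = λ k≤τ → col-< (n<1+n _) (odd-< k≤τ)
        ; down = λ k<τ → col-< (n<1+n _) (even-< k<τ)
        }
      incident : ∀ i {j} (f : ℕ → Bool) → (∀ c → entry (S₀ t) i c ≡ f (toℕ c)) → j < 2 * t → f j ≡ true →
                 Incident d (toℕ (ρ i)) (toℕ (κ (col j)))
      incident i {j} f S₀≡f j< fj≡true = does≡true⇒ (incident? d _ _) (trans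
        (sym (entry-fromPredicate n (λ i j → does (incident? d i j)) (ρ i) (κ (col j))))
        (ones i (col j) (trans (S₀≡f (col j)) (trans (cong f (toℕ-col j<)) fj≡true))))
      inc-y : ∀ {k} → k ≤ τ → Incident d (toℕ (ρ pattern₀)) (y k)
      inc-y {k} k≤τ = incident pattern₀ (λ j → j % 2 ≡ᵇ 0) (Vec.lookup∘tabulate _) (even-< k≤τ)
        (cong (_≡ᵇ 0) (m*n%n≡0 k 2))
      inc-z : ∀ {k} → k ≤ τ → Incident d (toℕ (ρ pattern₂)) (z k)
      inc-z {k} k≤τ = incident pattern₂ (λ j → j % 2 ≡ᵇ 1) (Vec.lookup∘tabulate _) (odd-< k≤τ)
        (cong (_≡ᵇ 1) ([m+kn]%n≡m%n 1 k 2))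
      first : Incident d (toℕ (ρ pattern₁)) (y 0)
      first = incident pattern₁ (λ j → (j ≡ᵇ 0) ∨ (j ≡ᵇ 2 * t ∸ 1)) (Vec.lookup∘tabulate _) (even-< {0} z≤n) refl
      last : Incident d (toℕ (ρ pattern₁)) (z τ)
      last = incident pattern₁ (λ j → (j ≡ᵇ 0) ∨ (j ≡ᵇ 2 * t ∸ 1)) (Vec.lookup∘tabulate _) (odd-< {τ} ≤-refl)
        (dec-true (suc (τ * 2) ≟ 2 * t ∸ 1) (cong (_∸ 1) (*-comm t 2)))

    Cols*S≤Ex : ∀ d {n} → S * Rows d ≤ n → Cols d ≤ n → Cols d * S ≤ Ex (S₀ t) n
    Cols*S≤Ex d {n} rows≤n cols≤n = ≤-trans (weight-incidenceMatrix d rows≤n cols≤n)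
      (weight≤Ex (S₀ t) (incidenceMatrix d n) (incidenceMatrix-free d n))

  -- Choice of the parameters

  n<m^n : ∀ m n → 2 ≤ m → n < m ^ n
  n<m^n m zero    _   = z<s
  n<m^n m (suc n) 2≤m = begin
    suc (suc n)        ≤⟨ +-mono-≤ (s≤s (z≤n {n})) (n<m^n m n 2≤m) ⟩
    suc n + m ^ n      ≤⟨ +-monoˡ-≤ (m ^ n) (n<m^n m n 2≤m) ⟩
    m ^ n + m ^ n      ≡⟨ cong (m ^ n +_) (+-identityʳ (m ^ n)) ⟨
    2 * m ^ n          ≤⟨ *-monoˡ-≤ (m ^ n) 2≤m ⟩
    m * m ^ n          ∎
    where open ≤-Reasoning

  ^-distribʳ-* : ∀ m n k → (m * n) ^ k ≡ m ^ k * n ^ k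
  ^-distribʳ-* m n zero    = refl
  ^-distribʳ-* m n (suc k) = trans (cong (m * n *_) (^-distribʳ-* m n k)) (interchange m n (m ^ k) (n ^ k))
    where
    interchange : ∀ a b c d → a * b * (c * d) ≡ a * c * (b * d)
    interchange = solve-∀

  -- A Bernoulli inequality, (1 + 1/m)^j ≤ m/(m - j), cleared of fractions. Each step moves a unit
  -- from `j` to `r` by (1 + m) r ≤ m (1 + r).
  [1+m]^j*r≤m^j*m : ∀ {m} j r → j + r ≡ m → suc m ^ j * r ≤ m ^ j * m
  [1+m]^j*r≤m^j*m zero    r refl = ≤-refl
  [1+m]^j*r≤m^j*m {m} (suc j) r eq = begin
    suc m * suc m ^ j * r      ≡⟨ rotate (suc m) (suc m ^ j) r ⟩
    suc m ^ j * (suc m * r)    ≤⟨ *-monoʳ-≤ (suc m ^ j) (+-monoˡ-≤ (m * r) r≤m) ⟩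
    suc m ^ j * (m + m * r)    ≡⟨ rotate′ (suc m ^ j) m r ⟩
    m * (suc m ^ j * suc r)    ≤⟨ *-monoʳ-≤ m ([1+m]^j*r≤m^j*m j (suc r) (trans (+-suc j r) eq)) ⟩
    m * (m ^ j * m)            ≡⟨ *-assoc m (m ^ j) m ⟨
    m * m ^ j * m              ∎
    where
    open ≤-Reasoning
    r≤m : r ≤ m
    r≤m = ≤-trans (m≤n+m r (suc j)) (≤-reflexive eq)
    rotate : ∀ a b c → a * b * c ≡ b * (a * c)
    rotate = solve-∀
    rotate′ : ∀ a m r → a * (m + m * r) ≡ m * (a * suc r)
    rotate′ = solve-∀

  -- With the parameters below it makes `R ^ d` at most twice `P ^ d`.
  [1+2d]^d≤2*[2d]^d : ∀ d → suc (d + d) ^ d ≤ 2 * (d + d) ^ d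
  [1+2d]^d≤2*[2d]^d zero      = s≤s z≤n
  [1+2d]^d≤2*[2d]^d d@(suc _) = *-cancelʳ-≤ _ _ d
    (≤-trans ([1+m]^j*r≤m^j*m d d refl) (≤-reflexive (double ((d + d) ^ d) d)))
    where
    double : ∀ a d → a * (d + d) ≡ 2 * a * d
    double = solve-∀

  module Parameters (τ : ℕ) (2≤t : 2 ≤ suc τ) (k u : ℕ) where

    private
      t : ℕ
      t = suc τ

    -- `b` prevents carries, `Q` exceeds `t` times every norm, and `L` bounds the variation of `h`,
    -- for which the shift `M` = `t * L` is steep enough. `P` is chosen so that R/P is 1 + 1/(2d);
    -- `C` counts the lines of one level.
    q b S Q L M H d P R C : ℕ
    q = t ^ u
    b = t * q
    S = q ^ k
    Q = t * (q * q * t ^ k)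
    L = b ^ k * Q
    M = t * L
    H = M + L
    d = u * k + 1
    P = (d + d) * (H * t)
    R = suc (d + d) * (H * t)
    C = P * t

    private
      instance
        q≢0 : NonZero q
        q≢0 = m^n≢0 t u
        L≢0 : NonZero L
        L≢0 = m*n≢0 (b ^ k) Q {{m^n≢0 b k {{m*n≢0 t q}}}}
          {{m*n≢0 t _ {{_}} {{m*n≢0 (q * q) (t ^ k) {{m*n≢0 q q}} {{m^n≢0 t k}}}}}}
        P≢0 : NonZero P
        P≢0 = m*n≢0 (d + d) (H * t) {{>-nonZero (<-≤-trans (subst (0 <_) (+-comm 1 (u * k)) z<s) (m≤m+n d d))}}
          {{m*n≢0 H t {{>-nonZero (<-≤-trans (>-nonZero⁻¹ L) (m≤n+m L M))}}}}

      open Paraboloid b q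

      h : ℕ → ℕ
      h = lift M Q k

      q≤b : q ≤ b
      q≤b = m≤n*m q t

      t*normSq<Q : ∀ s → t * normSq k s < Q
      t*normSq<Q s = *-monoʳ-< t (<-≤-trans (normSq-< k s (>-nonZero⁻¹ (q * q) {{m*n≢0 q q}}) ≤-refl)
        (*-monoʳ-≤ (q * q) (^-monoˡ-≤ k 2≤t)))

      h<H : ∀ {s} → s < S → h s < H
      h<H = lift-< {t} M k q≤b ≤-refl t*normSq<Q z<s

      steep : ∀ {s s″} → s < S → s″ < S → (h s″ ∸ h s) * t ≤ h s
      steep {s} {s″} s<S s″<S = begin
        (h s″ ∸ h s) * t   ≤⟨ *-monoˡ-≤ t (∸-mono (<⇒≤ (h<H s″<S)) (m≤m+n M _)) ⟩
        (M + L ∸ M) * t    ≡⟨ cong (_* t) (m+n∸m≡n M L) ⟩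
        L * t              ≡⟨ *-comm L t ⟩
        M                  ≤⟨ m≤m+n M _ ⟩
        h s                ∎
        where open ≤-Reasoning

      -- Rows must not outnumber columns. The loss from `P ^ d` to `R ^ d` is at most 2, hence at
      -- most `t`, and the 1 in `d` gives `S * t` = `t ^ d`.
      S*R^d≤C^d : S * R ^ d ≤ C ^ d
      S*R^d≤C^d = begin
        S * (suc (d + d) * (H * t)) ^ d                ≡⟨ cong (S *_) (^-distribʳ-* (suc (d + d)) (H * t) d) ⟩
        S * (suc (d + d) ^ d * (H * t) ^ d)            ≤⟨ *-monoʳ-≤ S (*-monoˡ-≤ ((H * t) ^ d) ([1+2d]^d≤2*[2d]^d d)) ⟩
        S * (2 * (d + d) ^ d * (H * t) ^ d)            ≤⟨ *-monoʳ-≤ S (*-monoˡ-≤ ((H * t) ^ d) (*-monoˡ-≤ ((d + d) ^ d) 2≤t)) ⟩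
        S * (t * (d + d) ^ d * (H * t) ^ d)            ≡⟨ rotate S t ((d + d) ^ d) ((H * t) ^ d) ⟩
        ((d + d) ^ d * (H * t) ^ d) * (S * t)          ≡⟨ cong₂ _*_ (sym (^-distribʳ-* (d + d) (H * t) d)) S*t≡t^d ⟩
        P ^ d * t ^ d                                  ≡⟨ ^-distribʳ-* P t d ⟨
        (P * t) ^ d                                    ∎
        where
        open ≤-Reasoning
        rotate : ∀ a b c d → a * (b * c * d) ≡ c * d * (a * b)
        rotate = solve-∀
        S*t≡t^d : S * t ≡ t ^ d
        S*t≡t^d = trans (cong₂ _*_ (^-*-assoc t u k) (sym (^-identityʳ t))) (sym (^-distribˡ-+-* t (u * k) 1))

    Ex-≥-multiple : ∀ {n} K .{{_ : NonZero K}} → C ^ d * K ≤ n → C ^ d * K * S ≤ Ex (S₀ t) n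
    Ex-≥-multiple {n} K C^d*K≤n = Lines.Cols*S≤Ex τ h S H P R K
      (lift-mono-< {t} M k q≤b ≤-refl t*normSq<Q z<s)
      h<H steep
      (lift-noWeightedMean {t} M k q≤b ≤-refl t*normSq<Q z<s)
      (≤-reflexive P+Ht≡R)
      d (≤-trans (≤-reflexive (sym (*-assoc S (R ^ d) K))) (≤-trans (*-monoˡ-≤ K S*R^d≤C^d) C^d*K≤n)) C^d*K≤n
      where
      P+Ht≡R : P + H * t ≡ R
      P+Ht≡R = +-comm P (H * t)

    -- The largest multiple of `C ^ d` up to `n` exceeds n/2, which costs the factor 2.
    Ex-> : ∀ {n} → C ^ d ≤ n → n * S < 2 * Ex (S₀ t) n
    Ex-> {n} C^d≤n = begin-strict
      n * S                        <⟨ *-monoˡ-< S {{m^n≢0 q k}} n<2NK ⟩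
      2 * (N * K) * S              ≡⟨ *-assoc 2 (N * K) S ⟩
      2 * (N * K * S)              ≤⟨ *-monoʳ-≤ 2 (Ex-≥-multiple K {{>-nonZero 1≤K}} (≤-trans (≤-reflexive (*-comm N K)) (m/n*n≤m n N))) ⟩
      2 * Ex (S₀ t) n              ∎
      where
      open ≤-Reasoning
      N = C ^ d
      instance
        N≢0 : NonZero N
        N≢0 = m^n≢0 C d {{m*n≢0 P t}}
      K = n / N
      1≤K : 1 ≤ K
      1≤K = m≥n⇒m/n>0 C^d≤n
      n<2NK : n < 2 * (N * K)
      n<2NK = begin-strict
        n                ≡⟨ m≡m%n+[m/n]*n n N ⟩
        n % N + K * N    <⟨ +-monoˡ-< (K * N) (m%n<n n N) ⟩
        N + K * N        ≤⟨ +-monoˡ-≤ (K * N) (m≤n*m N K {{>-nonZero 1≤K}}) ⟩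
        K * N + K * N    ≡⟨ double K N ⟩
        2 * (N * K)      ∎
        where
        double : ∀ K N → K * N + K * N ≡ 2 * (N * K)
        double = solve-∀

    -- Size of the construction.

    exponent : ℕ
    exponent = u * k + (3 * u + 3 * k + 6)

    -- The main term `u * k` comes from `b ^ k` in `L`. All other factors together contribute only
    -- `3 * u + 3 * k + 6`.
    C≤t^exponent : C ≤ t ^ exponent
    C≤t^exponent = begin
      (d + d) * ((t * L + L) * t) * t
        ≤⟨ *-monoˡ-≤ t (*-mono-≤ d+d≤ (*-monoˡ-≤ t H≤)) ⟩
      t * (t ^ u * t ^ k) * (t * (t * L) * t) * t
        ≡⟨ cong (λ x → t * (t ^ u * t ^ k) * (t * (t * x) * t) * t) L≡ ⟩
      t * (t ^ u * t ^ k) * (t * (t * (t ^ k * t ^ (u * k) * (t * (t ^ u * t ^ u * t ^ k)))) * t) * t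
        ≡⟨ collect t (t ^ u) (t ^ k) (t ^ (u * k)) ⟩
      t ^ (u * k) * ((t ^ u * (t ^ u * (t ^ u * 1)) * (t ^ k * (t ^ k * (t ^ k * 1)))) * (t * (t * (t * (t * (t * (t * 1)))))))
        ≡⟨ cong₂ (λ x y → t ^ (u * k) * (x * y * t ^ 6)) (cube u) (cube k) ⟩
      t ^ (u * k) * (t ^ (3 * u) * t ^ (3 * k) * t ^ 6)
        ≡⟨ cong (λ x → t ^ (u * k) * (x * t ^ 6)) (^-distribˡ-+-* t (3 * u) (3 * k)) ⟨
      t ^ (u * k) * (t ^ (3 * u + 3 * k) * t ^ 6)
        ≡⟨ cong (t ^ (u * k) *_) (^-distribˡ-+-* t (3 * u + 3 * k) 6) ⟨
      t ^ (u * k) * t ^ (3 * u + 3 * k + 6)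
        ≡⟨ ^-distribˡ-+-* t (u * k) (3 * u + 3 * k + 6) ⟨
      t ^ exponent ∎
      where
      open ≤-Reasoning
      cube : ∀ e → (t ^ e) ^ 3 ≡ t ^ (3 * e)
      cube e = trans (^-*-assoc t e 3) (cong (t ^_) (*-comm e 3))
      collect : ∀ t x y z → t * (x * y) * (t * (t * (y * z * (t * (x * x * y)))) * t) * t
        ≡ z * ((x * (x * (x * 1)) * (y * (y * (y * 1)))) * (t * (t * (t * (t * (t * (t * 1)))))))
      collect = solve-∀
      L≡ : L ≡ t ^ k * t ^ (u * k) * Q
      L≡ = cong (_* Q) (trans (^-distribʳ-* t q k) (cong (t ^ k *_) (^-*-assoc t u k)))
      d+d≤ : d + d ≤ t * (t ^ u * t ^ k)
      d+d≤ = begin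
        d + d                    ≡⟨ cong (d +_) (+-identityʳ d) ⟨
        2 * d                    ≤⟨ *-mono-≤ 2≤t d≤ ⟩
        t * (t ^ u * t ^ k)      ∎
        where
        expand : ∀ u k → u * k + 1 + (u + k) ≡ suc u * suc k
        expand = solve-∀
        d≤ : d ≤ t ^ u * t ^ k
        d≤ = ≤-trans (m≤m+n d (u + k)) (≤-trans (≤-reflexive (expand u k)) (*-mono-≤ (n<m^n t u 2≤t) (n<m^n t k 2≤t)))
      H≤ : t * L + L ≤ t * (t * L)
      H≤ = begin
        t * L + L          ≤⟨ +-monoʳ-≤ (t * L) (m≤n*m L t) ⟩
        t * L + t * L      ≡⟨ cong (t * L +_) (+-identityʳ (t * L)) ⟨
        2 * (t * L)        ≤⟨ *-monoˡ-≤ (t * L) 2≤t ⟩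
        t * (t * L)        ∎

  -- Logarithm to base `t` of the bound on `C ^ d`. It is about (u k)² against a gain of
  -- `t ^ (u * k)`, whence the square root in the theorem.
  log-size : ℕ → ℕ → ℕ
  log-size k u = (u * k + (3 * u + 3 * k + 6)) * (u * k + 1)

  Ex-lowerBound : ∀ {t n} k u → 2 ≤ t → t ^ log-size k u ≤ n → n * t ^ (u * k) < 2 * Ex (S₀ t) n
  Ex-lowerBound {t@(suc τ)} {n} k u 2≤t size≤n =
    subst (λ S → n * S < 2 * Ex (S₀ t) n) (^-*-assoc t u k)
      (Ex-> (≤-trans (≤-trans (^-monoˡ-≤ d C≤t^exponent) (≤-reflexive (^-*-assoc t exponent d))) size≤n))
    where open Parameters τ 2≤t k u

open Combinatorics using (Ex-lowerBound; log-size; n<m^n)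

open import Data.Nat.Base using (ℕ; _≤_)
open import Data.Product.Base using (∃-syntax)
open import Data.Rational.Base using (ℚ; 0ℚ; 1ℚ; _-_; _<_)

open import Data.Empty using (⊥)
open import Data.Integer.Base as ℤ using (+_; -[1+_])
import Data.Integer.Properties as ℤ
import Data.Nat.Base as ℕ
open import Data.Nat.Base using (zero; suc; z≤n; s≤s)
open import Data.Nat.Coprimality using (Coprime; 1-coprimeTo) renaming (sym to coprime-sym)
import Data.Nat.Properties as ℕ
import Data.Nat.Tactic.RingSolver as ℕ-Solver
open import Data.Product.Base using (∃; _×_; _,_; proj₁; proj₂)
open import Data.Rational.Base as ℚ using (mkℚ; ½; _/_; ↥_; ↧ₙ_; toℚᵘ)
import Data.Rational.Properties as ℚ
open import Data.Rational.Solver using (module +-*-Solver)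
import Data.Rational.Unnormalised.Base as ℚᵘ
import Data.Rational.Unnormalised.Properties as ℚᵘ
open import Data.Sum.Base using (inj₁; inj₂)
open import Relation.Binary.PropositionalEquality
open import Relation.Nullary using (yes; no; ¬_; contradiction)

-- Arithmetic of rationals

-- The gcd in the quotient does not evaluate for a variable `n`; the explicit form computes.
ℕ→ℚ≡mkℚ : ∀ n → ℕ→ℚ n ≡ mkℚ (+ n) 0 (coprime-sym (1-coprimeTo n))
ℕ→ℚ≡mkℚ n = ℚ.normalize-coprime {n} {0} (coprime-sym (1-coprimeTo n))

ℕ→ℚ-mono-≤ : ∀ {m n} → m ≤ n → ℕ→ℚ m ℚ.≤ ℕ→ℚ n
ℕ→ℚ-mono-≤ {m} {n} m≤n rewrite ℕ→ℚ≡mkℚ m | ℕ→ℚ≡mkℚ n = ℚ.*≤*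
  (subst₂ ℤ._≤_ (sym (ℤ.*-identityʳ (+ m))) (sym (ℤ.*-identityʳ (+ n))) (ℤ.+≤+ m≤n))

ℕ→ℚ-mono-< : ∀ {m n} → m ℕ.< n → ℕ→ℚ m < ℕ→ℚ n
ℕ→ℚ-mono-< {m} {n} m<n rewrite ℕ→ℚ≡mkℚ m | ℕ→ℚ≡mkℚ n = ℚ.*<*
  (subst₂ ℤ._<_ (sym (ℤ.*-identityʳ (+ m))) (sym (ℤ.*-identityʳ (+ n))) (ℤ.+<+ m<n))

≤⇒≯ : ∀ {p q} → p ℚ.≤ q → ¬ (q < p)
≤⇒≯ p≤q q<p = ℚ.<-irrefl refl (ℚ.≤-<-trans p≤q q<p)

ℕ→ℚ-cancel-≤ : ∀ {m n} → ℕ→ℚ m ℚ.≤ ℕ→ℚ n → m ≤ n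
ℕ→ℚ-cancel-≤ m≤n = ℕ.≮⇒≥ λ n<m → ≤⇒≯ m≤n (ℕ→ℚ-mono-< n<m)

ℕ→ℚ-+ : ∀ m n → ℕ→ℚ (m ℕ.+ n) ≡ ℕ→ℚ m ℚ.+ ℕ→ℚ n
ℕ→ℚ-+ m n rewrite ℕ→ℚ≡mkℚ m | ℕ→ℚ≡mkℚ n = cong (_/ 1)
  (sym (cong₂ ℤ._+_ (ℤ.*-identityʳ (+ m)) (ℤ.*-identityʳ (+ n))))

ℕ→ℚ-* : ∀ m n → ℕ→ℚ (m ℕ.* n) ≡ ℕ→ℚ m ℚ.* ℕ→ℚ n
ℕ→ℚ-* m n rewrite ℕ→ℚ≡mkℚ m | ℕ→ℚ≡mkℚ n = cong (_/ 1) (ℤ.pos-* m n)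

ℕ→ℚ-^ : ∀ m n → ℕ→ℚ (m ℕ.^ n) ≡ ℕ→ℚ m ^ℚ n
ℕ→ℚ-^ m zero    = refl
ℕ→ℚ-^ m (suc n) = trans (ℕ→ℚ-* m (m ℕ.^ n)) (cong (ℕ→ℚ m ℚ.*_) (ℕ→ℚ-^ m n))

0≤ℕ→ℚ : ∀ n → 0ℚ ℚ.≤ ℕ→ℚ n
0≤ℕ→ℚ n = ℕ→ℚ-mono-≤ {0} {n} z≤n

*-mono-≤ : ∀ {p q r s} → 0ℚ ℚ.≤ q → 0ℚ ℚ.≤ r → p ℚ.≤ q → r ℚ.≤ s → p ℚ.* r ℚ.≤ q ℚ.* s
*-mono-≤ {p} {q} {r} {s} 0≤q 0≤r p≤q r≤s = ℚ.≤-trans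
  (ℚ.*-monoʳ-≤-nonNeg r {{ℚ.nonNegative 0≤r}} p≤q)
  (ℚ.*-monoˡ-≤-nonNeg q {{ℚ.nonNegative 0≤q}} r≤s)

0≤* : ∀ {p q} → 0ℚ ℚ.≤ p → 0ℚ ℚ.≤ q → 0ℚ ℚ.≤ p ℚ.* q
0≤* {p} {q} 0≤p 0≤q = *-mono-≤ {0ℚ} {p} {0ℚ} {q} 0≤p ℚ.≤-refl 0≤p 0≤q

0<* : ∀ {p q} → 0ℚ < p → 0ℚ < q → 0ℚ < p ℚ.* q
0<* {p} {q} 0<p 0<q = subst (_< p ℚ.* q) (ℚ.*-zeroʳ p) (ℚ.*-monoʳ-<-pos p {{ℚ.positive 0<p}} 0<q)

0≤^ : ∀ {p} n → 0ℚ ℚ.≤ p → 0ℚ ℚ.≤ p ^ℚ n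
0≤^ zero    0≤p = 0≤ℕ→ℚ 1
0≤^ (suc n) 0≤p = 0≤* 0≤p (0≤^ n 0≤p)

^-mono-≤ : ∀ {p q} n → 0ℚ ℚ.≤ p → p ℚ.≤ q → p ^ℚ n ℚ.≤ q ^ℚ n
^-mono-≤ zero    0≤p p≤q = ℚ.≤-refl
^-mono-≤ (suc n) 0≤p p≤q = *-mono-≤ (ℚ.≤-trans 0≤p p≤q) (0≤^ n 0≤p) p≤q (^-mono-≤ n 0≤p p≤q)

0≤½ : 0ℚ ℚ.≤ ½
0≤½ = ℚ.*≤* (ℤ.+≤+ z≤n)

½<1 : ½ < 1ℚ
½<1 = ℚ.*<* (ℤ.+<+ (s≤s (s≤s z≤n)))

½^n≤1 : ∀ n → ½ ^ℚ n ℚ.≤ 1ℚ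
½^n≤1 zero    = ℚ.≤-refl
½^n≤1 (suc n) = *-mono-≤ {½} {1ℚ} (0≤ℕ→ℚ 1) (0≤^ n 0≤½) (ℚ.<⇒≤ ½<1) (½^n≤1 n)

½^1+n<1 : ∀ n → ½ ^ℚ suc n < 1ℚ
½^1+n<1 n = ℚ.≤-<-trans (*-mono-≤ {½} {½} {½ ^ℚ n} {1ℚ} 0≤½ (0≤^ n 0≤½) ℚ.≤-refl (½^n≤1 n)) ½<1

-- Rational bounds on logarithms and exponents.

scaled-≤ : ∀ E G {p d p′ d′} .{c : Coprime p (suc d)} .{c′ : Coprime p′ (suc d′)} → p ℕ.* (E ℕ.* suc d′) ≤ p′ ℕ.* (G ℕ.* suc d) →
  ℕ→ℚ E ℚ.* mkℚ (+ p) d c ℚ.≤ ℕ→ℚ G ℚ.* mkℚ (+ p′) d′ c′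
scaled-≤ E G {p} {d} {p′} {d′} {c} {c′} le rewrite ℕ→ℚ≡mkℚ E | ℕ→ℚ≡mkℚ G = ℚ.toℚᵘ-cancel-≤ (begin
  toℚᵘ (e ℚ.* mkℚ (+ p) d c)                  ≃⟨ ℚ.toℚᵘ-homo-* e (mkℚ (+ p) d c) ⟩
  toℚᵘ e ℚᵘ.* toℚᵘ (mkℚ (+ p) d c)            ≤⟨ ℚᵘ.*≤* (subst₂ ℤ._≤_ (expand E p d′) (expand G p′ d)
                                                   (ℤ.+≤+ (subst₂ _≤_ (regroup p E (suc d′)) (regroup p′ G (suc d)) le))) ⟩
  toℚᵘ g ℚᵘ.* toℚᵘ (mkℚ (+ p′) d′ c′)         ≃⟨ ℚ.toℚᵘ-homo-* g (mkℚ (+ p′) d′ c′) ⟨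
  toℚᵘ (g ℚ.* mkℚ (+ p′) d′ c′)               ∎)
  where
  open ℚᵘ.≤-Reasoning
  e g : ℚ
  e = mkℚ (+ E) 0 (coprime-sym (1-coprimeTo E))
  g = mkℚ (+ G) 0 (coprime-sym (1-coprimeTo G))
  regroup : ∀ p E d → p ℕ.* (E ℕ.* d) ≡ (E ℕ.* p) ℕ.* (1 ℕ.* d)
  regroup = ℕ-Solver.solve-∀
  expand : ∀ E p d → + ((E ℕ.* p) ℕ.* (1 ℕ.* suc d)) ≡ (+ E ℤ.* + p) ℤ.* + (1 ℕ.* suc d)
  expand E p d = trans (ℤ.pos-* (E ℕ.* p) (1 ℕ.* suc d)) (cong (ℤ._* + (1 ℕ.* suc d)) (ℤ.pos-* E p))

-- This eliminates log t between p/d ≤ G log t and E log t ≤ p′/e, by raising each inequality of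
-- powers to the exponent of the other.
power-compare : ∀ {t p d E e p′} G → 2 ℕ.^ p ≤ t ℕ.^ (G ℕ.* d) → t ℕ.^ (E ℕ.* e) ≤ 2 ℕ.^ p′ →
  p ℕ.* (E ℕ.* e) ≤ p′ ℕ.* (G ℕ.* d)
power-compare {t} {p} {d} {E} {e} {p′} G 2^p≤ t^Ee≤ = ℕ.≮⇒≥ λ lt → ℕ.<⇒≱ (ℕ.^-monoʳ-< 2 (s≤s (s≤s z≤n)) lt) (begin
  2 ℕ.^ (p ℕ.* (E ℕ.* e))               ≡⟨ ℕ.^-*-assoc 2 p (E ℕ.* e) ⟨
  (2 ℕ.^ p) ℕ.^ (E ℕ.* e)               ≤⟨ ℕ.^-monoˡ-≤ (E ℕ.* e) 2^p≤ ⟩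
  (t ℕ.^ (G ℕ.* d)) ℕ.^ (E ℕ.* e)       ≡⟨ ℕ.^-*-assoc t (G ℕ.* d) (E ℕ.* e) ⟩
  t ℕ.^ ((G ℕ.* d) ℕ.* (E ℕ.* e))       ≡⟨ cong (t ℕ.^_) (ℕ.*-comm (G ℕ.* d) (E ℕ.* e)) ⟩
  t ℕ.^ ((E ℕ.* e) ℕ.* (G ℕ.* d))       ≡⟨ ℕ.^-*-assoc t (E ℕ.* e) (G ℕ.* d) ⟨
  (t ℕ.^ (E ℕ.* e)) ℕ.^ (G ℕ.* d)       ≤⟨ ℕ.^-monoˡ-≤ (G ℕ.* d) t^Ee≤ ⟩
  (2 ℕ.^ p′) ℕ.^ (G ℕ.* d)              ≡⟨ ℕ.^-*-assoc 2 p′ (G ℕ.* d) ⟩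
  2 ℕ.^ (p′ ℕ.* (G ℕ.* d))              ∎)
  where open ℕ.≤-Reasoning

log₂-numerator : ∀ {n p d} .{c : Coprime p (suc d)} → log₂ n (mkℚ (+ p) d c) → 2 ℕ.^ p ≤ n ℕ.^ suc d
log₂-numerator {n} {p} {d} α<log = ℕ→ℚ-cancel-≤ (subst (ℚ._≤ ℕ→ℚ (n ℕ.^ suc d)) (sym (ℕ→ℚ-^ 2 p)) (ℚ.<⇒≤ α<log))

-- With α < log t, β < W² log t, r ≥ E log t and a W < E, the number r lies above a √(α β).
incompatible-bounds : ∀ {E W r a b α β} → 0ℚ ℚ.≤ E → 0ℚ ℚ.≤ W → 0ℚ ℚ.≤ a → 0ℚ ℚ.≤ b →
  0ℚ ℚ.≤ α → 0ℚ ℚ.≤ β → 0ℚ < r → r ℚ.≤ a ℚ.* b → b ℚ.* b ℚ.≤ α ℚ.* β →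
  E ℚ.* α ℚ.≤ r → E ℚ.* β ℚ.≤ W ℚ.* W ℚ.* r → W ℚ.* a < E → ⊥
incompatible-bounds {E} {W} {r} {a} {b} {α} {β} 0≤E 0≤W 0≤a 0≤b 0≤α 0≤β 0<r r≤ab bb≤αβ Eα≤r Eβ≤WWr Wa<E =
  ≤⇒≯ upper (ℚ.*-monoˡ-<-pos (α ℚ.* β) {{ℚ.positive 0<αβ}} squares)
  where
  open ℚ.≤-Reasoning
  open +-*-Solver
  0≤r : 0ℚ ℚ.≤ r
  0≤r = ℚ.<⇒≤ 0<r
  0≤ab : 0ℚ ℚ.≤ a ℚ.* b
  0≤ab = 0≤* 0≤a 0≤b
  0≤Wa : 0ℚ ℚ.≤ W ℚ.* a
  0≤Wa = 0≤* 0≤W 0≤a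
  rr≤ : r ℚ.* r ℚ.≤ (a ℚ.* a) ℚ.* (α ℚ.* β)
  rr≤ = begin
    r ℚ.* r                          ≤⟨ *-mono-≤ 0≤ab 0≤r r≤ab r≤ab ⟩
    (a ℚ.* b) ℚ.* (a ℚ.* b)          ≡⟨ solve 2 (λ a b → (a :* b) :* (a :* b) := (a :* a) :* (b :* b)) refl a b ⟩
    (a ℚ.* a) ℚ.* (b ℚ.* b)          ≤⟨ ℚ.*-monoˡ-≤-nonNeg (a ℚ.* a) {{ℚ.nonNegative (0≤* 0≤a 0≤a)}} bb≤αβ ⟩
    (a ℚ.* a) ℚ.* (α ℚ.* β)          ∎
  -- Multiplying the bounds on `E * α` and `E * β` gives E² α β ≤ W² r², and r² ≤ a² α β. This
  -- contradicts W a < E, because r > 0 makes α β positive.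
  upper : (E ℚ.* E) ℚ.* (α ℚ.* β) ℚ.≤ ((W ℚ.* a) ℚ.* (W ℚ.* a)) ℚ.* (α ℚ.* β)
  upper = begin
    (E ℚ.* E) ℚ.* (α ℚ.* β)          ≡⟨ solve 3 (λ E α β → (E :* E) :* (α :* β) := (E :* α) :* (E :* β)) refl E α β ⟩
    (E ℚ.* α) ℚ.* (E ℚ.* β)          ≤⟨ *-mono-≤ 0≤r (0≤* 0≤E 0≤β) Eα≤r Eβ≤WWr ⟩
    r ℚ.* (W ℚ.* W ℚ.* r)            ≡⟨ solve 2 (λ W r → r :* (W :* W :* r) := (W :* W) :* (r :* r)) refl W r ⟩
    (W ℚ.* W) ℚ.* (r ℚ.* r)          ≤⟨ ℚ.*-monoˡ-≤-nonNeg (W ℚ.* W) {{ℚ.nonNegative (0≤* 0≤W 0≤W)}} rr≤ ⟩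
    (W ℚ.* W) ℚ.* ((a ℚ.* a) ℚ.* (α ℚ.* β))
      ≡⟨ solve 3 (λ W a x → (W :* W) :* ((a :* a) :* x) := ((W :* a) :* (W :* a)) :* x) refl W a (α ℚ.* β) ⟩
    ((W ℚ.* a) ℚ.* (W ℚ.* a)) ℚ.* (α ℚ.* β) ∎
  0<E : 0ℚ < E
  0<E = ℚ.≤-<-trans 0≤Wa Wa<E
  squares : (W ℚ.* a) ℚ.* (W ℚ.* a) < E ℚ.* E
  squares = ℚ.≤-<-trans (ℚ.*-monoˡ-≤-nonNeg (W ℚ.* a) {{ℚ.nonNegative 0≤Wa}} (ℚ.<⇒≤ Wa<E))
    (ℚ.*-monoˡ-<-pos E {{ℚ.positive 0<E}} Wa<E)
  0<αβ : 0ℚ < α ℚ.* β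
  0<αβ = ℚ.≰⇒> λ αβ≤0 → ≤⇒≯
    (ℚ.≤-trans rr≤ (subst ((a ℚ.* a) ℚ.* (α ℚ.* β) ℚ.≤_) (ℚ.*-zeroʳ (a ℚ.* a))
      (ℚ.*-monoˡ-≤-nonNeg (a ℚ.* a) {{ℚ.nonNegative (0≤* 0≤a 0≤a)}} αβ≤0)))
    (0<* 0<r 0<r)

module _ {t n E W : ℕ} {δ : ℚ} (2≤t : 2 ≤ t) (1≤E : 1 ≤ E) (1≤W : 1 ≤ W)
  (n≤t^WW : n ≤ t ℕ.^ (W ℕ.* W)) (Wδ≤E : ℕ→ℚ W ℚ.* δ ℚ.≤ ℕ→ℚ E) where

  private
    -- From n ≤ t^(W²) follows √(log t log n) ≤ W log t, so the cut lies below E log t, whereas the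
    -- refuted inequality says r ≥ E log t.
    exponent-bound : ∀ {r} → (fromℚ δ *ᴿ √ (log₂ t *ᴿ log₂ n)) r →
      ¬ (ℕ→ℚ (t ℕ.^ E) ^ℚ ↧ₙ r ℚ.≤ 2^ℤ (↥ r))
    exponent-bound {mkℚ -[1+ p ] d c} r∈ le = ≤⇒≯
      (ℚ.≤-trans (subst (1ℚ ℚ.≤_) (ℕ→ℚ-^ (t ℕ.^ E) (suc d)) (ℕ→ℚ-mono-≤ {1}
        (ℕ.m^n>0 (t ℕ.^ E) {{ℕ.m^n≢0 t E {{ℕ.>-nonZero (ℕ.<-trans (s≤s z≤n) 2≤t)}}}} (suc d)))) le)
      (½^1+n<1 p)
    exponent-bound {r@(mkℚ (+ p) d c)} (inj₁ r<0) le = ≤⇒≯ (ℚ.nonNegative⁻¹ r) r<0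
    exponent-bound {mkℚ (+ p) d c} (inj₂ (a , b , a<δ , inj₁ b<0 , 0≤a , 0≤b , r≤ab)) le = ≤⇒≯ 0≤b b<0
    exponent-bound {mkℚ (+ p) d c} (inj₂ (a , b , a<δ , inj₂ (inj₁ bb<0) , 0≤a , 0≤b , r≤ab)) le = ≤⇒≯ (0≤* 0≤b 0≤b) bb<0
    exponent-bound {mkℚ (+ p) d c}
      (inj₂ (a , b , a<δ , inj₂ (inj₂ (α@(mkℚ -[1+ _ ] _ _) , β , _ , _ , 0≤α , _)) , _)) le = ≤⇒≯ 0≤α (ℚ.negative⁻¹ α)
    exponent-bound {mkℚ (+ p) d c}
      (inj₂ (a , b , a<δ , inj₂ (inj₂ (α , β@(mkℚ -[1+ _ ] _ _) , _ , _ , _ , 0≤β , _)) , _)) le = ≤⇒≯ 0≤β (ℚ.negative⁻¹ β)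
    exponent-bound {r@(mkℚ (+ p) d c)}
      (inj₂ (a , b , a<δ , inj₂ (inj₂ (α@(mkℚ (+ p₁) d₁ c₁) , β@(mkℚ (+ p₂) d₂ c₂) , α<log , β<log , 0≤α , 0≤β , bb≤αβ))
          , 0≤a , 0≤b , r≤ab)) le =
      -- `E * α ≤ r` comes from α < log t and E log t ≤ r; the bound on `E * β` uses β < log n ≤ W²
      -- log t instead.
      incompatible-bounds (0≤ℕ→ℚ E) (0≤ℕ→ℚ W) 0≤a 0≤b 0≤α 0≤β 0<r r≤ab bb≤αβ
        (subst (ℕ→ℚ E ℚ.* α ℚ.≤_) (ℚ.*-identityˡ r) (scaled-≤ E 1 {p₁} {d₁} {p} {d} {c₁} {c}
          (power-compare {t} {p₁} {suc d₁} {E} {suc d} {p} 1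
              (subst (λ e → 2 ℕ.^ p₁ ≤ t ℕ.^ e) (sym (ℕ.*-identityˡ (suc d₁)))
                (log₂-numerator {t} {p₁} {d₁} {c₁} α<log)) t^Ed≤2^p)))
        (subst (λ x → ℕ→ℚ E ℚ.* β ℚ.≤ x ℚ.* r) (ℕ→ℚ-* W W) (scaled-≤ E (W ℕ.* W) {p₂} {d₂} {p} {d} {c₂} {c}
          (power-compare {t} {p₂} {suc d₂} {E} {suc d} {p} (W ℕ.* W) (ℕ.≤-trans (log₂-numerator {n} {p₂} {d₂} {c₂} β<log)
            (subst (n ℕ.^ suc d₂ ≤_) (ℕ.^-*-assoc t (W ℕ.* W) (suc d₂)) (ℕ.^-monoˡ-≤ (suc d₂) n≤t^WW))) t^Ed≤2^p)))
        (ℚ.<-≤-trans (ℚ.*-monoʳ-<-pos (ℕ→ℚ W) {{ℚ.positive (ℕ→ℚ-mono-< 1≤W)}} a<δ) Wδ≤E)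
      where
      t^Ed≤2^p : t ℕ.^ (E ℕ.* suc d) ≤ 2 ℕ.^ p
      t^Ed≤2^p = subst (_≤ 2 ℕ.^ p) (ℕ.^-*-assoc t E (suc d)) (ℕ→ℚ-cancel-≤
        (subst₂ ℚ._≤_ (sym (ℕ→ℚ-^ (t ℕ.^ E) (suc d))) (sym (ℕ→ℚ-^ 2 p)) le))
      0<p : 0 ℕ.< p
      0<p = ℕ.≰⇒> λ p≤0 → ℕ.<⇒≱ (ℕ.^-monoʳ-< t 2≤t (ℕ.*-mono-≤ 1≤E (s≤s (z≤n {d}))))
        (ℕ.≤-trans t^Ed≤2^p (ℕ.^-monoʳ-≤ 2 p≤0))
      0<r : 0ℚ < r
      0<r = ℚ.positive⁻¹ r {{ℤ.positive (ℤ.+<+ 0<p)}}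

  exp₂-bound : ∀ {b} → 0ℚ ℚ.≤ b → exp₂ (fromℚ δ *ᴿ √ (log₂ t *ᴿ log₂ n)) b → b ℚ.≤ ℕ→ℚ (t ℕ.^ E)
  exp₂-bound 0≤b (inj₁ b<0) = contradiction b<0 (≤⇒≯ 0≤b)
  exp₂-bound 0≤b (inj₂ (r , r∈ , b^d≤2^p)) = ℚ.≮⇒≥ λ T<b → exponent-bound r∈
    (ℚ.≤-trans (^-mono-≤ (↧ₙ r) (0≤ℕ→ℚ (t ℕ.^ E)) (ℚ.<⇒≤ T<b)) b^d≤2^p)

-- Passage to the asymptotic form

-- An upward search from `u₀`. It ends within `n` further steps, since `f` at n + u₀ + 1 already
-- exceeds `n`.
bracket : (f : ℕ → ℕ) → (∀ u → u ≤ f u) → ∀ {u₀ n} → f u₀ ≤ n →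
  ∃ λ u → u₀ ≤ u × f u ≤ n × n ℕ.< f (suc u)
bracket f grows {u₀} {n} f₀≤n = go n u₀ (ℕ.≤-trans (s≤s (ℕ.m≤m+n n u₀)) (grows (suc (n ℕ.+ u₀)))) ℕ.≤-refl f₀≤n
  where
  go : ∀ j u → n ℕ.< f (suc (j ℕ.+ u)) → u₀ ≤ u → f u ≤ n → ∃ λ u → u₀ ≤ u × f u ≤ n × n ℕ.< f (suc u)
  go zero    u n<f u₀≤u fu≤n = u , u₀≤u , fu≤n , n<f
  go (suc j) u n<f u₀≤u fu≤n with n ℕ.<? f (suc u)
  ... | yes n<fu⁺ = u , u₀≤u , fu≤n , n<fu⁺
  ... | no  n≮fu⁺ = go j (suc u) (subst (λ v → n ℕ.< f (suc v)) (sym (ℕ.+-suc j u)) n<f)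
    (ℕ.m≤n⇒m≤1+n u₀≤u) (ℕ.≮⇒≥ n≮fu⁺)

u≤t^log-size : ∀ {t} k u → 2 ≤ t → u ≤ t ℕ.^ log-size k u
u≤t^log-size {t} k u 2≤t = ℕ.≤-trans u≤log-size (ℕ.<⇒≤ (n<m^n t (log-size k u) 2≤t))
  where
  expand : ∀ u k → u ℕ.+ (u ℕ.* k ℕ.+ (2 ℕ.* u ℕ.+ 3 ℕ.* k ℕ.+ 6)) ≡ u ℕ.* k ℕ.+ (3 ℕ.* u ℕ.+ 3 ℕ.* k ℕ.+ 6)
  expand = ℕ-Solver.solve-∀
  u≤log-size : u ≤ log-size k u
  u≤log-size = ℕ.≤-trans (ℕ.≤-trans (ℕ.m≤m+n u _) (ℕ.≤-reflexive (expand u k)))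
    (ℕ.m≤m*n _ (u ℕ.* k ℕ.+ 1) {{ℕ.>-nonZero (ℕ.≤-trans (s≤s z≤n) (ℕ.m≤n+m 1 (u ℕ.* k)))}})

-- Both factors of the next size are at most u k + 3 u + (4 k + 9), and `u` absorbs the bracket. The
-- resulting width exceeds `u * k` only by the factor 1 + 4/k.
log-size-suc-≤ : ∀ {k u} → 4 ℕ.* k ℕ.+ 9 ≤ u →
  log-size k (suc u) ≤ (u ℕ.* (k ℕ.+ 4)) ℕ.* (u ℕ.* (k ℕ.+ 4))
log-size-suc-≤ {k} {u} 4k+9≤u = ℕ.*-mono-≤
  (ℕ.≤-trans (ℕ.≤-reflexive (expand₁ u k)) (ℕ.≤-trans (ℕ.+-monoʳ-≤ _ 4k+9≤u) (ℕ.≤-reflexive (collect u k))))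
  (ℕ.≤-trans (ℕ.m≤m+n _ (3 ℕ.* u ℕ.+ 3 ℕ.* k ℕ.+ 8)) (ℕ.≤-trans (ℕ.≤-reflexive (expand₂ u k))
    (ℕ.≤-trans (ℕ.+-monoʳ-≤ _ 4k+9≤u) (ℕ.≤-reflexive (collect u k)))))
  where
  expand₁ : ∀ u k → suc u ℕ.* k ℕ.+ (3 ℕ.* suc u ℕ.+ 3 ℕ.* k ℕ.+ 6) ≡ u ℕ.* k ℕ.+ 3 ℕ.* u ℕ.+ (4 ℕ.* k ℕ.+ 9)
  expand₁ = ℕ-Solver.solve-∀
  expand₂ : ∀ u k → suc u ℕ.* k ℕ.+ 1 ℕ.+ (3 ℕ.* u ℕ.+ 3 ℕ.* k ℕ.+ 8) ≡ u ℕ.* k ℕ.+ 3 ℕ.* u ℕ.+ (4 ℕ.* k ℕ.+ 9)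
  expand₂ = ℕ-Solver.solve-∀
  collect : ∀ u k → u ℕ.* k ℕ.+ 3 ℕ.* u ℕ.+ u ≡ u ℕ.* (k ℕ.+ 4)
  collect = ℕ-Solver.solve-∀

-- At least 5 / ε.
inverse-scale : ℚ → ℕ
inverse-scale ε = 5 ℕ.* ↧ₙ ε

5u≤u[k+4]ε : ∀ {ε} u → 0ℚ < ε → ℕ→ℚ (5 ℕ.* u) ℚ.≤ ℕ→ℚ (u ℕ.* (inverse-scale ε ℕ.+ 4)) ℚ.* ε
5u≤u[k+4]ε {ε@(mkℚ (+ zero) _ _)} u 0<ε = contradiction 0<ε (≤⇒≯ (ℚ.nonPositive⁻¹ ε))
5u≤u[k+4]ε {ε@(mkℚ -[1+ _ ] _ _)} u 0<ε = contradiction 0<ε (≤⇒≯ (ℚ.nonPositive⁻¹ ε))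
5u≤u[k+4]ε {ε@(mkℚ (+ suc p) d c)} u _ = subst (ℚ._≤ ℕ→ℚ W ℚ.* ε) (ℚ.*-identityʳ (ℕ→ℚ (5 ℕ.* u)))
  (scaled-≤ (5 ℕ.* u) W {1} {0} {suc p} {d} {1-coprimeTo 1} {c} (begin
    1 ℕ.* (5 ℕ.* u ℕ.* suc d)                       ≤⟨ ℕ.m≤m+n _ (4 ℕ.* u) ⟩
    1 ℕ.* (5 ℕ.* u ℕ.* suc d) ℕ.+ 4 ℕ.* u           ≡⟨ expand u (suc d) ⟩
    W ℕ.* 1                                         ≤⟨ ℕ.m≤n*m (W ℕ.* 1) (suc p) ⟩
    suc p ℕ.* (W ℕ.* 1)                             ∎))
  where
  open ℕ.≤-Reasoning
  W : ℕ
  W = u ℕ.* (inverse-scale ε ℕ.+ 4)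
  expand : ∀ u d → 1 ℕ.* (5 ℕ.* u ℕ.* d) ℕ.+ 4 ℕ.* u ≡ u ℕ.* (5 ℕ.* d ℕ.+ 4) ℕ.* 1
  expand = ℕ-Solver.solve-∀

-- `W * ε` is at least `5 * u`, which outweighs the excess of `W` over `E`.
scaled-width : ∀ {ε} {E} u → 0ℚ < ε → let W = u ℕ.* (inverse-scale ε ℕ.+ 4) in
  W ≤ E ℕ.+ 5 ℕ.* u → ℕ→ℚ W ℚ.* (1ℚ - ε) ℚ.≤ ℕ→ℚ E
scaled-width {ε} {E} u 0<ε W≤E+5u = begin
  w ℚ.* (1ℚ - ε)                      ≡⟨ solve 2 (λ w ε → w :* (con 1ℚ :- ε) := w :- w :* ε) refl w ε ⟩
  w - w ℚ.* ε                         ≤⟨ ℚ.+-mono-≤ (ℕ→ℚ-mono-≤ W≤E+5u) (ℚ.neg-antimono-≤ (5u≤u[k+4]ε u 0<ε)) ⟩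
  ℕ→ℚ (E ℕ.+ 5 ℕ.* u) - ℕ→ℚ (5 ℕ.* u) ≡⟨ cong (_- ℕ→ℚ (5 ℕ.* u)) (ℕ→ℚ-+ E (5 ℕ.* u)) ⟩
  ℕ→ℚ E ℚ.+ ℕ→ℚ (5 ℕ.* u) - ℕ→ℚ (5 ℕ.* u)
    ≡⟨ solve 2 (λ e x → e :+ x :- x := e) refl (ℕ→ℚ E) (ℕ→ℚ (5 ℕ.* u)) ⟩
  ℕ→ℚ E                               ∎
  where
  open ℚ.≤-Reasoning
  open +-*-Solver
  w : ℚ
  w = ℕ→ℚ (u ℕ.* (inverse-scale ε ℕ.+ 4))

theorem2p2 : (t : ℕ) → 2 ≤ t →
    (ε : ℚ) → 0ℚ < ε → ε < 1ℚ →
    ∃[ N ] ((n : ℕ) → N ≤ n →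
    fromℕ n *ᴿ exp₂ (fromℚ (1ℚ - ε) *ᴿ √ (log₂ t *ᴿ log₂ n))
    ≤ᴿ fromℕ (Ex (S₀ t) n))
theorem2p2 t 2≤t ε 0<ε ε<1 = t ℕ.^ log-size k u₀ , λ n N≤n {q} → bound n N≤n {q}
  where
  k u₀ : ℕ
  k = inverse-scale ε
  -- The threshold from which `log-size-suc-≤` applies.
  u₀ = 4 ℕ.* k ℕ.+ 9
  bound : ∀ n → t ℕ.^ log-size k u₀ ≤ n →
    fromℕ n *ᴿ exp₂ (fromℚ (1ℚ - ε) *ᴿ √ (log₂ t *ᴿ log₂ n)) ≤ᴿ fromℕ (Ex (S₀ t) n)
  bound n N≤n (inj₁ q<0) = ℚ.<-≤-trans q<0 (0≤ℕ→ℚ (Ex (S₀ t) n))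
  bound n N≤n {q} (inj₂ (a , b , a<n , b∈exp₂ , 0≤a , 0≤b , q≤ab)) = begin-strict
    q                              ≤⟨ q≤ab ⟩
    a ℚ.* b                        ≤⟨ *-mono-≤ (0≤ℕ→ℚ n) 0≤b (ℚ.<⇒≤ a<n) b≤t^E ⟩
    ℕ→ℚ n ℚ.* ℕ→ℚ (t ℕ.^ E)        ≡⟨ ℕ→ℚ-* n (t ℕ.^ E) ⟨
    ℕ→ℚ (n ℕ.* t ℕ.^ E)            <⟨ ℕ→ℚ-mono-< n*t^E<Ex ⟩
    ℕ→ℚ (Ex (S₀ t) n)              ∎
    where
    open ℚ.≤-Reasoning
    bracketed = bracket (λ u → t ℕ.^ log-size k u) (λ u → u≤t^log-size k u 2≤t) N≤n
    u E W : ℕ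
    u = proj₁ bracketed
    -- One unit of the exponent is given up: as `2 ≤ t`, it pays for the factor 2 in
    -- `Ex-lowerBound`.
    E = u ℕ.* k ℕ.∸ 1
    W = u ℕ.* (k ℕ.+ 4)
    u₀≤u : u₀ ≤ u
    u₀≤u = proj₁ (proj₂ bracketed)
    0<u : 0 ℕ.< u
    0<u = ℕ.≤-trans (ℕ.≤-trans (s≤s z≤n) (ℕ.m≤n+m 9 (4 ℕ.* k))) u₀≤u
    2≤uk : 2 ≤ u ℕ.* k
    2≤uk = ℕ.*-mono-≤ 0<u (ℕ.≤-trans (s≤s (s≤s z≤n)) (ℕ.m≤m*n 5 (↧ₙ ε)))
    1+E≡uk : suc E ≡ u ℕ.* k
    1+E≡uk = ℕ.m+[n∸m]≡n (ℕ.<⇒≤ 2≤uk)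
    b≤t^E : b ℚ.≤ ℕ→ℚ (t ℕ.^ E)
    b≤t^E = exp₂-bound {t} {n} {E} {W} 2≤t (ℕ.∸-monoˡ-≤ 1 2≤uk) (ℕ.*-mono-≤ 0<u (ℕ.≤-trans (s≤s z≤n) (ℕ.m≤n+m 4 k)))
      (ℕ.≤-trans (ℕ.<⇒≤ (proj₂ (proj₂ (proj₂ bracketed))))
        (ℕ.^-monoʳ-≤ t {{ℕ.>-nonZero (ℕ.<-trans (s≤s z≤n) 2≤t)}} (log-size-suc-≤ {k} u₀≤u)))
      (scaled-width {ε} {E} u 0<ε W≤E+5u) 0≤b b∈exp₂
      where
      expand : ∀ u k → 1 ℕ.+ u ℕ.* (k ℕ.+ 4) ≡ u ℕ.* k ℕ.+ (4 ℕ.* u ℕ.+ 1)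
      expand = ℕ-Solver.solve-∀
      -- `W` is E + 1 + 4 u, and the 1 is at most `u`.
      W≤E+5u : W ≤ E ℕ.+ 5 ℕ.* u
      W≤E+5u = ℕ.≤-pred (ℕ.≤-trans (ℕ.≤-reflexive (expand u k)) (ℕ.+-mono-≤ (ℕ.≤-reflexive (sym 1+E≡uk))
        (ℕ.≤-trans (ℕ.+-monoʳ-≤ (4 ℕ.* u) 0<u) (ℕ.≤-reflexive (ℕ.+-comm (4 ℕ.* u) u)))))
    n*t^E<Ex : n ℕ.* t ℕ.^ E ℕ.< Ex (S₀ t) n
    n*t^E<Ex = ℕ.*-cancelˡ-< 2 _ _ (ℕ.≤-<-trans 2nt^E≤nt^uk (Ex-lowerBound k u 2≤t (proj₁ (proj₂ (proj₂ bracketed)))))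
      where
      rotate : ∀ t n x → t ℕ.* (n ℕ.* x) ≡ n ℕ.* (t ℕ.* x)
      rotate = ℕ-Solver.solve-∀
      2nt^E≤nt^uk : 2 ℕ.* (n ℕ.* t ℕ.^ E) ≤ n ℕ.* t ℕ.^ (u ℕ.* k)
      2nt^E≤nt^uk = ℕ.≤-trans (ℕ.*-monoˡ-≤ (n ℕ.* t ℕ.^ E) 2≤t)
        (ℕ.≤-reflexive (trans (rotate t n (t ℕ.^ E)) (cong (λ e → n ℕ.* t ℕ.^ e) 1+E≡uk)))
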